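{- Testing identity with a known distribution can be done by an adaptive algorithm using $\mathrm{poly}(\log^\star n,\epsilon^{ -1},\log(\delta^{ -1}))$ conditional samples. That is, there is a polynomial $p$ such that for all $\epsilon,\delta\in(0,1)$, all $n$ and every explicitly given distribution $\mu$ over $[n]$, there is an adaptive algorithm that makes at most $p(\log^\star n,\epsilon^{ -1},\log(\delta^{ -1}))$ conditional samples from an unknown distribution $\mu'$ over $[n]$, accepts with probability at least $1-\delta$ if $\mu'=\mu$, and rejects with probability at least $1-\delta$ if $d(\mu,\mu')\ge\epsilon$.
   Context: $[n]=\{1,\ldots,n\}$; the variation distance is $d(\mu,\mu')=\frac12\sum_{i=1}^n|\mu(i)-\mu'(i)|$. Define $\log^{(0)}(n)=n$, $\log^{(k+1)}(n)=\log(\log^{(k)}(n))$, and $\log^\star(n)=\min\{k:\log^{(k)}(n)\le1\}$. A conditional sample from $\mu'$ with a nonempty set $A\subseteq[n]$ is an element $j\in A$ drawn with probability $\mu'(j)/\mu'(A)$ if $\mu'(A)>0$, and uniformly from $A$ if $\mu'(A)=0$, independently of all previous samples. An adaptive algorithm is a randomized algorithm that may choose each conditioning set based on the previously received samples and its internal coin tosses, and finally accepts or rejects based on the received samples and its coin tosses. -}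

module Defs where

open import Algebra.Bundles using (CommutativeRing)
open import Algebra.Core using (Op₁; Op₂)
open import Algebra.Structures using (IsCommutativeRing)
open import Data.Bool.Base using (Bool; true; false; if_then_else_)
open import Data.Fin.Base using (Fin)
open import Data.Fin.Subset using (Subset; Nonempty; ∣_∣)
open import Data.Fin.Subset.Properties using (_∈?_)
open import Data.Nat.Base as ℕ using (ℕ; zero; suc; z≤n; s≤s)
import Data.Nat.Properties as ℕₚ
open import Data.Product.Base using (∃; _×_; _,_; proj₁; proj₂)
open import Data.Sum.Base using (inj₁; inj₂)
open import Data.Vec.Base using (Vec)
open import Data.Vec.Functional as Vector using (Vector)
open import Function.Base using (id)
open import Level using (0ℓ)
open import Relation.Binary.Core using (Rel)
open import Relation.Binary.PropositionalEquality.Core as ≡ using (_≡_)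
open import Relation.Binary.Structures using (IsDecTotalOrder)
import Relation.Binary.Construct.NonStrictToStrict as Strict
import Relation.Binary.Reasoning.Setoid
open import Relation.Nullary.Decidable.Core using (Dec; yes; no; does)
open import Relation.Nullary.Negation.Core using (¬_; contradiction)
open import Relation.Unary using (Pred; Decidable)
import Algebra.Properties.Ring
import Algebra.Properties.Semiring.Exp
import Algebra.Properties.Semiring.Mult
import Algebra.Properties.Semiring.Sum
import Tactic.RingSolver.Core.Expression as Expression

-- The library has no real numbers, so ℝ is characterised in the usual way as
-- the (classically unique) complete ordered field.  `archimedean` and the
-- decidability of the order follow classically from the other axioms; they are
-- listed because they cannot be derived constructively.  The value of 0# ⁻¹ is
-- left unspecified.
record CompleteOrderedField : Set₁ where
  infix  8 _⁻¹
  infix  8 -_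
  infixl 7 _*_
  infixl 6 _+_
  infix  4 _≈_ _≤_
  field
    Carrier           : Set
    _≈_ _≤_           : Rel Carrier 0ℓ
    _+_ _*_           : Op₂ Carrier
    -_ _⁻¹            : Op₁ Carrier
    0# 1#             : Carrier
    isCommutativeRing : IsCommutativeRing _≈_ _+_ _*_ -_ 0# 1#
    1≉0               : ¬ (1# ≈ 0#)
    ⁻¹-inverseʳ       : ∀ x → ¬ (x ≈ 0#) → x * x ⁻¹ ≈ 1#
    isDecTotalOrder   : IsDecTotalOrder _≈_ _≤_
    +-monoˡ-≤         : ∀ z {x y} → x ≤ y → x + z ≤ y + z
    *-nonneg          : ∀ {x y} → 0# ≤ x → 0# ≤ y → 0# ≤ x * y

  commutativeRing : CommutativeRing 0ℓ 0ℓ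
  commutativeRing = record { isCommutativeRing = isCommutativeRing }

  open CommutativeRing commutativeRing public
    using (_-_; rawRing; ring; semiring; setoid)

  open Algebra.Properties.Semiring.Mult semiring public
    using () renaming (_×_ to _·_)

  fromℕ : ℕ → Carrier
  fromℕ n = n · 1#

  UpperBound : Pred Carrier 0ℓ → Pred Carrier 0ℓ
  UpperBound P b = ∀ {x} → P x → x ≤ b

  IsSupremum : Pred Carrier 0ℓ → Pred Carrier 0ℓ
  IsSupremum P s = UpperBound P s × (∀ b → UpperBound P b → s ≤ b)

  field
    archimedean : ∀ x → ∃ λ n → x ≤ fromℕ n
    complete    : (P : Pred Carrier 0ℓ) → ∃ P → ∃ (UpperBound P) →
                  ∃ (IsSupremum P)

Least : Pred ℕ 0ℓ → Pred ℕ 0ℓ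
Least P k = P k × (∀ j → P j → k ℕ.≤ j)

least : {P : Pred ℕ 0ℓ} → Decidable P → ∃ P → ∃ (Least P)
least {P} P? (n , pn) = search n P P? pn
  where
  search : ∀ n (P : Pred ℕ 0ℓ) → Decidable P → P n → ∃ (Least P)
  search zero    P P? p = 0 , p , λ _ _ → z≤n
  search (suc n) P P? p with P? 0
  ... | yes p₀ = 0 , p₀ , λ _ _ → z≤n
  ... | no ¬p₀ with search n (λ k → P (suc k)) (λ k → P? (suc k)) p
  ...   | k , pk , min = suc k , pk , λ
          { zero    p₀ → contradiction p₀ ¬p₀
          ; (suc j) pj → s≤s (min j pj)
          }

-- A randomized adaptive algorithm as a decision tree: `output true` accepts
-- and `output false` rejects; `toss k` is an internal toss of a fair
-- (k+1)-sided coin; `sample A` requests a conditional sample from A.  The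
-- branches of `sample A` at points outside A are taken with probability 0.
data Algorithm (n : ℕ) : Set where
  output : Bool → Algorithm n
  toss   : (k : ℕ) → (Fin (suc k) → Algorithm n) → Algorithm n
  sample : (A : Subset n) → Nonempty A → (Fin n → Algorithm n) → Algorithm n

-- The maximum number of conditional samples over all runs.
sampleCount : ∀ {n} → Algorithm n → ℕ
sampleCount (output _)     = 0
sampleCount (toss _ T)     = Vector.foldr ℕ._⊔_ 0 (λ i → sampleCount (T i))
sampleCount (sample _ _ T) = suc (Vector.foldr ℕ._⊔_ 0 (λ j → sampleCount (T j)))

module Reals (ℝ : CompleteOrderedField) where

  open CompleteOrderedField ℝ public
  open IsDecTotalOrder isDecTotalOrder public
    using (_≟_; _≤?_; total; antisym)
    renaming (refl to ≤-refl; trans to ≤-trans; reflexive to ≤-reflexive)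
  open Strict _≈_ _≤_ public using (_<_; <-decidable)

  infix 4 _<?_
  _<?_ : ∀ x y → Dec (x < y)
  _<?_ = <-decidable _≟_ _≤?_

  open Algebra.Properties.Semiring.Exp semiring public using (_^_)
  open Algebra.Properties.Semiring.Sum semiring public using (sum; sum-syntax)

  2# : Carrier
  2# = 1# + 1#

  abs : Carrier → Carrier
  abs x = if does (0# ≤? x) then x else - x

  Polynomial : ℕ → Set
  Polynomial = Expression.Expr Carrier

  eval : ∀ {k} → Polynomial k → Vec Carrier k → Carrier
  eval = Expression.Eval.⟦_⟧ rawRing id

  -- The rationals z = (a − b)/(c+1) with 2^z ≤ x, as 2^a ≤ x^(c+1) · 2^b.
  BelowLog : Carrier → Pred Carrier 0ℓ
  BelowLog x z = ∃ λ a → ∃ λ b → ∃ λ c →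
    (z * fromℕ (suc c) ≈ fromℕ a - fromℕ b) ×
    (2# ^ a ≤ x ^ suc c * 2# ^ b)

  private
    module R where
      open CommutativeRing commutativeRing public hiding (ring; semiring)
      open Algebra.Properties.Ring ring public
      open Algebra.Properties.Semiring.Exp semiring public
      open Algebra.Properties.Semiring.Mult semiring public
        using (×-homo-+; ×1-homo-*)

    open Relation.Binary.Reasoning.Setoid setoid

    ≤-resp : ∀ {w x y z} → w ≈ x → y ≈ z → w ≤ y → x ≤ z
    ≤-resp w≈x y≈z w≤y =
      ≤-trans (≤-reflexive (R.sym w≈x)) (≤-trans w≤y (≤-reflexive y≈z))

    +-mono : ∀ {w x y z} → w ≤ x → y ≤ z → w + y ≤ x + z
    +-mono {_} {x} {y} w≤x y≤z = ≤-trans (+-monoˡ-≤ y w≤x)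
      (≤-resp (R.+-comm _ _) (R.+-comm _ _) (+-monoˡ-≤ x y≤z))

    ≤⇒0≤- : ∀ {x y} → x ≤ y → 0# ≤ y - x
    ≤⇒0≤- {x} x≤y = ≤-resp (R.-‿inverseʳ x) R.refl (+-monoˡ-≤ (- x) x≤y)

    0≤-⇒≤ : ∀ {x y} → 0# ≤ y - x → x ≤ y
    0≤-⇒≤ {x} {y} p = ≤-resp (R.+-identityˡ x)
      (begin
        y - x + x      ≈⟨ R.+-assoc _ _ _ ⟩
        y + (- x + x)  ≈⟨ R.+-congˡ (R.-‿inverseˡ x) ⟩
        y + 0#         ≈⟨ R.+-identityʳ y ⟩
        y              ∎)
      (+-monoˡ-≤ x p)

    *-monoʳ : ∀ {x y z} → 0# ≤ z → x ≤ y → z * x ≤ z * y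
    *-monoʳ {x} {y} {z} 0≤z x≤y = 0≤-⇒≤ (≤-resp R.refl
      (begin
        z * (y - x)        ≈⟨ R.distribˡ z y (- x) ⟩
        z * y + z * - x    ≈⟨ R.+-congˡ (R.sym (R.-‿distribʳ-* z x)) ⟩
        z * y - z * x      ∎)
      (*-nonneg 0≤z (≤⇒0≤- x≤y)))

    *-mono : ∀ {w x y z} → 0# ≤ y → 0# ≤ x → w ≤ x → y ≤ z → w * y ≤ x * z
    *-mono 0≤y 0≤x w≤x y≤z = ≤-trans
      (≤-resp (R.*-comm _ _) (R.*-comm _ _) (*-monoʳ 0≤y w≤x)) (*-monoʳ 0≤x y≤z)

    0≤1 : 0# ≤ 1#
    0≤1 with total 0# 1#
    ... | inj₁ p = p
    ... | inj₂ p = ≤-resp R.refl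
      (begin
        (0# - 1#) * (0# - 1#)  ≈⟨ R.*-cong (R.+-identityˡ _) (R.+-identityˡ _) ⟩
        - 1# * - 1#            ≈⟨ R.-1*x≈-x (- 1#) ⟩
        - - 1#                 ≈⟨ R.-‿involutive 1# ⟩
        1#                     ∎)
      (*-nonneg (≤⇒0≤- p) (≤⇒0≤- p))

    x≤x+y : ∀ {x y} → 0# ≤ y → x ≤ x + y
    x≤x+y {x} p = ≤-resp (R.+-identityʳ x) R.refl (+-mono ≤-refl p)

    0≤2 : 0# ≤ 2#
    0≤2 = ≤-trans 0≤1 (x≤x+y 0≤1)

    1≤2^ : ∀ m → 1# ≤ 2# ^ m
    1≤2^ zero    = ≤-refl
    1≤2^ (suc m) = ≤-resp (R.*-identityˡ 1#) R.refl
      (*-mono 0≤1 0≤2 (x≤x+y 0≤1) (1≤2^ m))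

    2x≈x+x : ∀ x → 2# * x ≈ x + x
    2x≈x+x x = R.trans (R.distribʳ x 1# 1#)
      (R.+-cong (R.*-identityˡ x) (R.*-identityˡ x))

    fromℕ-suc≤2^ : ∀ m → fromℕ (suc m) ≤ 2# ^ m
    fromℕ-suc≤2^ zero    = ≤-reflexive (R.+-identityʳ 1#)
    fromℕ-suc≤2^ (suc m) = ≤-resp R.refl (R.sym (2x≈x+x (2# ^ m)))
      (+-mono (1≤2^ m) (fromℕ-suc≤2^ m))

    fromℕ-mono : ∀ {m n} → m ℕ.≤ n → fromℕ m ≤ fromℕ n
    fromℕ-mono {n = zero}  z≤n     = ≤-refl
    fromℕ-mono {n = suc n} z≤n     = ≤-trans (fromℕ-mono {n = n} z≤n)
      (≤-resp R.refl (R.+-comm _ _) (x≤x+y 0≤1))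
    fromℕ-mono             (s≤s p) = +-mono ≤-refl (fromℕ-mono p)

    ≤2^ : ∀ x → ∃ λ m → x ≤ 2# ^ m
    ≤2^ x with archimedean x
    ... | m , x≤m = m , ≤-trans x≤m
      (≤-trans (fromℕ-mono (ℕₚ.n≤1+n m)) (fromℕ-suc≤2^ m))

    ^-nonneg : ∀ {x} → 0# ≤ x → ∀ m → 0# ≤ x ^ m
    ^-nonneg 0≤x zero    = 0≤1
    ^-nonneg 0≤x (suc m) = *-nonneg 0≤x (^-nonneg 0≤x m)

    ^-mono : ∀ {x y} → 0# ≤ x → x ≤ y → ∀ m → x ^ m ≤ y ^ m
    ^-mono 0≤x x≤y zero    = ≤-refl
    ^-mono 0≤x x≤y (suc m) =
      *-mono (^-nonneg 0≤x m) (≤-trans 0≤x x≤y) x≤y (^-mono 0≤x x≤y m)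

    2^-cancel : ∀ m n → 2# ^ m ≤ 2# ^ n → m ℕ.≤ n
    2^-cancel m n 2^m≤2^n with m ℕₚ.≤? n
    ... | yes m≤n = m≤n
    ... | no  m≰n = contradiction
      (antisym (0≤-⇒≤ (≤-resp R.refl eq (≤⇒0≤- 1+1≤1))) 0≤1) 1≉0
      where
      k = m ℕ.∸ suc n
      u = 2# ^ n
      0<u : ¬ (u ≈ 0#)
      0<u u≈0 = 1≉0 (antisym (≤-resp R.refl u≈0 (1≤2^ n)) 0≤1)
      2u≤u : u * 2# ≤ u * 1#
      2u≤u = ≤-resp (R.*-comm _ _) (R.sym (R.*-identityʳ u)) (≤-trans
        (≤-resp (R.*-identityʳ _)
          (R.trans (R.sym (R.^-homo-* 2# (suc n) k))
            (R.reflexive (≡.cong (2# ^_) (ℕₚ.m+[n∸m]≡n (ℕₚ.≰⇒> m≰n)))))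
          (*-monoʳ (*-nonneg 0≤2 (^-nonneg 0≤2 n)) (1≤2^ k)))
        2^m≤2^n)
      0≤u⁻¹ : 0# ≤ u ⁻¹
      0≤u⁻¹ with total 0# (u ⁻¹)
      ... | inj₁ p = p
      ... | inj₂ p = contradiction
        (antisym (≤-resp (⁻¹-inverseʳ u 0<u) (R.zeroʳ u)
          (*-monoʳ (^-nonneg 0≤2 n) p)) 0≤1) 1≉0
      cancel : ∀ x → u ⁻¹ * (u * x) ≈ x
      cancel x = begin
        u ⁻¹ * (u * x)  ≈⟨ R.*-assoc _ _ _ ⟨
        u ⁻¹ * u * x    ≈⟨ R.*-congʳ (R.*-comm _ _) ⟩
        u * u ⁻¹ * x    ≈⟨ R.*-congʳ (⁻¹-inverseʳ u 0<u) ⟩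
        1# * x          ≈⟨ R.*-identityˡ x ⟩
        x               ∎
      1+1≤1 : 2# ≤ 1#
      1+1≤1 = ≤-resp (cancel 2#) (cancel 1#) (*-monoʳ 0≤u⁻¹ 2u≤u)
      eq : 1# - 2# ≈ 0# - 1#
      eq = begin
        1# - (1# + 1#)        ≈⟨ R.+-congˡ (R.sym (R.-‿+-comm 1# 1#)) ⟩
        1# + (- 1# - 1#)      ≈⟨ R.+-assoc _ _ _ ⟨
        1# - 1# - 1#          ≈⟨ R.+-congʳ (R.-‿inverseʳ 1#) ⟩
        0# - 1#               ∎

    BelowLog-≤ : ∀ {x} m → 0# ≤ x → x ≤ 2# ^ m → UpperBound (BelowLog x) (fromℕ m)
    BelowLog-≤ {x} m 0≤x x≤2^m {z} (a , b , c , zq≈a-b , 2^a≤) with z ≤? fromℕ m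
    ... | yes z≤m = z≤m
    ... | no  z≰m = contradiction z≤m z≰m
      where
      q = suc c
      a≤mq+b : a ℕ.≤ m ℕ.* q ℕ.+ b
      a≤mq+b = 2^-cancel a _ (≤-trans 2^a≤ (≤-resp R.refl
        (R.trans (R.*-congʳ (R.^-assocʳ 2# m q)) (R.sym (R.^-homo-* 2# (m ℕ.* q) b)))
        (*-mono (^-nonneg 0≤2 b) (^-nonneg (^-nonneg 0≤2 m) q)
          (^-mono 0≤x x≤2^m q) ≤-refl)))
      zq≤mq : z * fromℕ q ≤ fromℕ m * fromℕ q
      zq≤mq = ≤-resp (R.sym zq≈a-b)
        (begin
          fromℕ (m ℕ.* q ℕ.+ b) - fromℕ b        ≈⟨ R.+-congʳ (R.×-homo-+ 1# (m ℕ.* q) b) ⟩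
          fromℕ (m ℕ.* q) + fromℕ b - fromℕ b    ≈⟨ R.+-assoc _ _ _ ⟩
          fromℕ (m ℕ.* q) + (fromℕ b - fromℕ b)  ≈⟨ R.+-congˡ (R.-‿inverseʳ _) ⟩
          fromℕ (m ℕ.* q) + 0#                   ≈⟨ R.+-identityʳ _ ⟩
          fromℕ (m ℕ.* q)                        ≈⟨ R.×1-homo-* m q ⟩
          fromℕ m * fromℕ q                      ∎)
        (+-monoˡ-≤ _ (fromℕ-mono a≤mq+b))
      m≤z : fromℕ m ≤ z
      m≤z with total z (fromℕ m)
      ... | inj₁ p = contradiction p z≰m
      ... | inj₂ p = p
      d = z - fromℕ m
      0≤d : 0# ≤ d
      0≤d = ≤⇒0≤- m≤z
      -- q ≥ 1 and d ≥ 0 give d ≤ d q = z q − m q ≤ 0.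
      d≤0 : d ≤ 0#
      d≤0 = ≤-trans
        (≤-resp (R.*-identityʳ d) R.refl
          (*-monoʳ 0≤d (x≤x+y (fromℕ-mono {n = c} z≤n))))
        (≤-resp
          (begin
            z * fromℕ q - fromℕ m * fromℕ q      ≈⟨ R.+-congˡ (R.-‿distribˡ-* _ _) ⟩
            z * fromℕ q + - fromℕ m * fromℕ q    ≈⟨ R.distribʳ _ _ _ ⟨
            d * fromℕ q                          ∎)
          (R.-‿inverseʳ (fromℕ m * fromℕ q))
          (+-monoˡ-≤ (- (fromℕ m * fromℕ q)) zq≤mq))
      z≤m : z ≤ fromℕ m
      z≤m = ≤-resp
        (begin
          z - fromℕ m + fromℕ m      ≈⟨ R.+-assoc _ _ _ ⟩
          z + (- fromℕ m + fromℕ m)  ≈⟨ R.+-congˡ (R.-‿inverseˡ _) ⟩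
          z + 0#                     ≈⟨ R.+-identityʳ z ⟩
          z                          ∎)
        (R.+-identityˡ _)
        (+-monoˡ-≤ (fromℕ m) d≤0)

  BelowLog-bounded : ∀ {x} → 0# < x → ∃ (UpperBound (BelowLog x))
  BelowLog-bounded {x} (0≤x , _) with ≤2^ x
  ... | m , x≤2^m = fromℕ m , BelowLog-≤ m 0≤x x≤2^m

  BelowLog-nonempty : ∀ {x} → 0# < x → ∃ (BelowLog x)
  BelowLog-nonempty {x} (0≤x , 0≉x) with ≤2^ (x ⁻¹)
  ... | m , x⁻¹≤2^m = (0# - fromℕ m) , 0 , m , 0 ,
    R.trans (R.*-congˡ (R.+-identityʳ 1#)) (R.*-identityʳ _) ,
    ≤-resp (⁻¹-inverseʳ x (λ p → 0≉x (R.sym p)))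
      (R.*-congʳ (R.sym (R.*-identityʳ x)))
      (*-monoʳ 0≤x x⁻¹≤2^m)

  log-supremum : ∀ {x} → 0# < x → ∃ (IsSupremum (BelowLog x))
  log-supremum {x} 0<x =
    complete (BelowLog x) (BelowLog-nonempty 0<x) (BelowLog-bounded 0<x)

  -- The binary logarithm; its value is arbitrary outside the positive reals.
  log : Carrier → Carrier
  log x with 0# <? x
  ... | yes 0<x = proj₁ (log-supremum 0<x)
  ... | no  _   = 0#

  log^ : ℕ → Carrier → Carrier
  log^ zero    x = x
  log^ (suc k) x = log (log^ k x)

  private
    log-≤ : ∀ {x} m → x ≤ 2# ^ m → log x ≤ fromℕ m
    log-≤ {x} m x≤2^m with 0# <? x
    ... | yes 0<x = proj₂ (proj₂ (log-supremum 0<x)) (fromℕ m)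
                      (BelowLog-≤ m (proj₁ 0<x) x≤2^m)
    ... | no  _   = fromℕ-mono {n = m} z≤n

    log^-≤ : ∀ n k → log^ k (fromℕ n) ≤ fromℕ (suc (n ℕ.∸ suc k))
    log^-≤ n zero    = fromℕ-mono (ℕₚ.m≤n+m∸n n 1)
    log^-≤ n (suc k) = ≤-trans
      (log-≤ (n ℕ.∸ suc k) (≤-trans (log^-≤ n k) (fromℕ-suc≤2^ (n ℕ.∸ suc k))))
      (fromℕ-mono (≡.subst (λ j → n ℕ.∸ suc k ℕ.≤ suc j)
        (≡.trans (ℕₚ.∸-+-assoc n (suc k) 1) (≡.cong (n ℕ.∸_) (ℕₚ.+-comm (suc k) 1)))
        (ℕₚ.m≤n+m∸n (n ℕ.∸ suc k) 1)))

  log⋆-exists : ∀ n → ∃ λ k → log^ k (fromℕ n) ≤ 1#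
  log⋆-exists n = n , ≤-trans (log^-≤ n n) (≤-trans
    (fromℕ-mono (s≤s (ℕₚ.≤-reflexive (ℕₚ.m≤n⇒m∸n≡0 (ℕₚ.n≤1+n n)))))
    (≤-reflexive (R.+-identityʳ 1#)))

  log⋆-least : ∀ n → ∃ (Least λ k → log^ k (fromℕ n) ≤ 1#)
  log⋆-least n = least (λ k → log^ k (fromℕ n) ≤? 1#) (log⋆-exists n)

  log⋆ : ℕ → ℕ
  log⋆ n = proj₁ (log⋆-least n)

  record Distribution (n : ℕ) : Set where
    field
      prob     : Vector Carrier n
      prob-≥0  : ∀ i → 0# ≤ prob i
      prob-sum : sum prob ≈ 1#

  open Distribution public

  infix 4 _≐_
  _≐_ : ∀ {n} → Distribution n → Distribution n → Set
  μ ≐ ν = ∀ i → prob μ i ≈ prob ν i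

  d : ∀ {n} → Distribution n → Distribution n → Carrier
  d {n} μ ν = 2# ⁻¹ * ∑[ i < n ] abs (prob μ i - prob ν i)

  mass : ∀ {n} → Distribution n → Subset n → Carrier
  mass {n} μ A = ∑[ i < n ] (if does (i ∈? A) then prob μ i else 0#)

  conditional : ∀ {n} → Distribution n → Subset n → Fin n → Carrier
  conditional μ A j =
    if does (j ∈? A)
    then (if does (0# <? mass μ A) then prob μ j * mass μ A ⁻¹ else fromℕ ∣ A ∣ ⁻¹)
    else 0#

  -- Pr μ T b is the probability that T outputs b when its conditional samples
  -- are drawn from μ.
  Pr : ∀ {n} → Distribution n → Algorithm n → Bool → Carrier
  Pr μ (output true)  true  = 1#
  Pr μ (output true)  false = 0#
  Pr μ (output false) true  = 0#
  Pr μ (output false) false = 1#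
  Pr μ (toss k T)     b = ∑[ i < suc k ] (fromℕ (suc k) ⁻¹ * Pr μ (T i) b)
  Pr {n} μ (sample A _ T) b = ∑[ j < n ] (conditional μ A j * Pr μ (T j) b)

{-# OPTIONS --safe #-}
module Submission where

-- A query is a set S of points with an event A in it.  Let a = μ(A | S).  Two
-- independent conditional samples x, y of μ′ from S give the score
-- (a - [x ∈ A]) (a - [y ∈ A]), whose mean is the square of the gap
-- μ(A | S) - μ′(A | S) (`𝔼-score`).  Suppose that queries can be drawn at random
-- so that the mean absolute gap is at least 1/G whenever μ′ is far from μ.  Then
-- a score lies in [-1, 1], and its mean is 0 if μ′ = μ and at least 1/G² if μ′ is
-- far from μ.
--
-- The two cases are told apart by betting.  Starting with wealth 1, a small
-- fraction of the current wealth is staked on each score, and μ′ is rejected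
-- if the final wealth exceeds 2^m.  If μ′ = μ, the expected wealth stays 1, so
-- Markov's inequality bounds the probability of rejection by 2^-m (`fair-bet`).
-- If μ′ is far from μ, the expected reciprocal of the wealth shrinks by a factor
-- 1 - 1/(8 G⁴) in each trial, so after 16 m G⁴ trials Markov's inequality bounds
-- the probability of acceptance by 2^-m (`favourable-bet`, `decay`).  With
-- 2^m ≥ 1/δ both errors are at most δ.
--
-- The queries come from a hierarchy of partitions of the n points.  A level
-- sorts the current blocks into buckets according to the scale of their μ-mass:
-- up to a factor 2, all blocks of a bucket have the same mass, except in one
-- bucket that collects the blocks of negligible mass.  The buckets are the blocks
-- of the next level.  As L blocks yield about log L buckets, log⋆ n levels leave
-- few blocks, and one last level joins these into a single bucket.
--
-- The L¹ distance between μ and μ′ on points is the sum over the levels of the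
-- distance lost by passing from blocks to buckets.  Let block i have masses pᵢ and
-- qᵢ under μ and μ′.  The loss within a bucket is controlled by the cross products
-- |pᵢ qⱼ - qᵢ pⱼ| of its blocks (`P*dev-≤`), and such a product is
-- (pᵢ + pⱼ)(qᵢ + qⱼ) times the absolute gap of the query whether a point of the
-- blocks i and j lies in i (`cross-identity`).  No block is much heavier than the
-- average of its bucket, so if j is the block of a sample of μ′ and i is a uniform
-- block of the same bucket, then the mean absolute gap bounds the loss of the level
-- (`dev-≤-found`, `distance-≤`).  Tossing for the level gives the random query.

open import Defs
open import Algebra.Bundles using (CommutativeRing; RawRing)
open import Algebra.Solver.Ring.AlmostCommutativeRing using (fromCommutativeRing; _-Raw-AlmostCommutative⟶_)
open import Data.Bool.Base using (Bool; true; false; if_then_else_; not; _∨_)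
open import Data.Bool.Properties using (∨-zeroʳ)
open import Data.Fin.Base using (Fin; zero; suc; toℕ)
open import Data.Fin.Subset using (Subset; Nonempty; ∣_∣; inside; outside; ⊤; _∈_)
open import Data.Fin.Subset.Properties using (_∈?_; ∈⊤)
open import Data.Integer.Base as ℤ using (ℤ)
open import Data.List.Base as List using (List; []; _∷_; length; lookup)
open import Data.Maybe.Base using (Maybe; just; nothing)
open import Data.Nat.Base as ℕ using (ℕ; zero; suc; z≤n; s≤s)
open import Data.Product.Base using (Σ; ∃; _×_; _,_; proj₁; proj₂)
open import Data.Sum.Base using (_⊎_; inj₁; inj₂)
open import Data.Vec.Base as Vec using (Vec; []; _∷_)
open import Data.Vec.Functional as Vector using (Vector)
open import Data.Vec.Properties using (lookup∘tabulate; lookup⇒[]=)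
open import Function.Base using (_∘_; id)
open import Relation.Binary.Bundles using (Poset)
open import Relation.Binary.PropositionalEquality.Core as ≡ using (_≡_; _≢_)
open import Relation.Binary.Structures using (IsDecTotalOrder)
open import Relation.Nullary.Decidable using (dec-true; dec-false)
open import Relation.Nullary.Decidable.Core using (Dec; yes; no; does)
open import Relation.Nullary.Negation.Core using (¬_; contradiction)
open import Tactic.RingSolver.Core.Expression using (Κ; Ι; _⊕_; _⊗_)
import Algebra.Properties.Ring
import Algebra.Properties.Semiring.Exp
import Algebra.Properties.Semiring.Mult
import Algebra.Properties.Semiring.Mult.TCOptimised
import Algebra.Properties.Semiring.Sum
import Algebra.Solver.Ring
import Data.Fin.Properties as Finₚ
import Data.Integer.Properties as ℤₚ
import Data.Nat.Properties as ℕₚ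
import Data.Nat.Solver
import Relation.Binary.Reasoning.PartialOrder
import Relation.Binary.Reasoning.Setoid

-- Programs with results of any type

-- Decision trees with leaves in X, so that a tester can be composed with the
-- monadic bind; those with Boolean leaves are the algorithms.
data Program (n : ℕ) (X : Set) : Set where
  ret  : X → Program n X
  toss : (k : ℕ) → (Fin (suc k) → Program n X) → Program n X
  draw : (A : Subset n) → Nonempty A → (Fin n → Program n X) → Program n X

infixl 1 _>>=_
_>>=_ : ∀ {n X Y} → Program n X → (X → Program n Y) → Program n Y
ret x       >>= k = k x
toss m T    >>= k = toss m λ i → T i >>= k
draw A ne T >>= k = draw A ne λ j → T j >>= k

toAlgorithm : ∀ {n} → Program n Bool → Algorithm n
toAlgorithm (ret b)       = output b
toAlgorithm (toss k T)    = toss k λ i → toAlgorithm (T i)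
toAlgorithm (draw A ne T) = sample A ne λ j → toAlgorithm (T j)

data Draws≤ {n X} : ℕ → Program n X → Set where
  ret  : ∀ {c x} → Draws≤ c (ret x)
  toss : ∀ {c k T} → (∀ i → Draws≤ c (T i)) → Draws≤ c (toss k T)
  draw : ∀ {c A ne T} → (∀ j → Draws≤ c (T j)) → Draws≤ (suc c) (draw A ne T)

Draws≤-weaken : ∀ {n X c d} {t : Program n X} → c ℕ.≤ d → Draws≤ c t → Draws≤ d t
Draws≤-weaken c≤d       ret      = ret
Draws≤-weaken c≤d       (toss p) = toss λ i → Draws≤-weaken c≤d (p i)
Draws≤-weaken (s≤s c≤d) (draw p) = draw λ j → Draws≤-weaken c≤d (p j)

Draws≤-bind : ∀ {n X Y c d} {t : Program n X} {k : X → Program n Y} →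
              Draws≤ c t → (∀ x → Draws≤ d (k x)) → Draws≤ (c ℕ.+ d) (t >>= k)
Draws≤-bind {c = c} {d} ret q = Draws≤-weaken (ℕₚ.m≤n+m d c) (q _)
Draws≤-bind (toss p)        q = toss λ i → Draws≤-bind (p i) q
Draws≤-bind (draw p)        q = draw λ j → Draws≤-bind (p j) q

maximum-≤ : ∀ {m c} {f : Fin m → ℕ} → (∀ i → f i ℕ.≤ c) → Vector.foldr ℕ._⊔_ 0 f ℕ.≤ c
maximum-≤ {zero}  p = z≤n
maximum-≤ {suc m} p = ℕₚ.⊔-lub (p zero) (maximum-≤ (p ∘ suc))

sampleCount-≤ : ∀ {n c} {t : Program n Bool} → Draws≤ c t → sampleCount (toAlgorithm t) ℕ.≤ c
sampleCount-≤ ret      = z≤n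
sampleCount-≤ (toss p) = maximum-≤ λ i → sampleCount-≤ (p i)
sampleCount-≤ (draw p) = s≤s (maximum-≤ λ j → sampleCount-≤ (p j))

-- Queries and their choice

record Query (n : ℕ) : Set where
  constructor query
  field
    domain   : Subset n
    nonempty : Nonempty domain
    event    : Fin n → Bool

open Query public

-- The default x₀ is the result of a choice from no candidates.
uniform : ∀ {n X} → X → List X → Program n X
uniform x₀ []           = ret x₀
uniform x₀ xs@(_ ∷ xs′) = toss (length xs′) λ k → ret (lookup xs k)

members : ∀ {L} → (Fin L → Bool) → List (Fin L)
members {zero}  s = []
members {suc L} s = if s zero then zero ∷ rest else rest
  where rest = List.map suc (members (s ∘ suc))

pairDomain : ∀ {n L} → (Fin n → Fin L) → Fin L → Fin L → Subset n
pairDomain c i j = Vec.tabulate λ x → does (i Finₚ.≟ c x) ∨ does (j Finₚ.≟ c x)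

∈-pairDomain : ∀ {n L} (c : Fin n → Fin L) i x → x ∈ pairDomain c i (c x)
∈-pairDomain c i x = lookup⇒[]= x _ (≡.trans (lookup∘tabulate _ x)
  (≡.trans (≡.cong (does (i Finₚ.≟ c x) ∨_) (dec-true (c x Finₚ.≟ c x) ≡.refl)) (∨-zeroʳ _)))

-- Given that a point lies in block i or in the block of x, is it in block i?
-- The point x shows that the domain is nonempty, even if block i is empty.
pairQuery : ∀ {n L} → (Fin n → Fin L) → Fin L → Fin n → Query n
pairQuery c i x = query (pairDomain c i (c x)) (x , ∈-pairDomain c i x) λ y → does (i Finₚ.≟ c y)

module _ {n} (x₀ : Fin n) where

  -- The query of one level with blocks c and buckets b: the point x is a plain
  -- sample, and its block is compared with a uniform block i of the same bucket.
  -- No coins are tossed to sample μ itself, which would only be possible for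
  -- rational probabilities.
  round : ∀ {L L′} → (Fin n → Fin L) → (Fin L → Fin L′) → Program n (Query n)
  round c b = draw ⊤ (x₀ , ∈⊤) λ x →
    uniform (c x) (members λ i → does (b (c x) Finₚ.≟ b i)) >>= λ i → ret (pairQuery c i x)

  Draws≤-round : ∀ {L L′} (c : Fin n → Fin L) (b : Fin L → Fin L′) → Draws≤ 1 (round c b)
  Draws≤-round c b = draw λ x →
    Draws≤-bind {c = 0} (Draws≤-uniform (members λ i → does (b (c x) Finₚ.≟ b i))) λ i → ret
    where
    Draws≤-uniform : ∀ {X x} (xs : List X) → Draws≤ {n} 0 (uniform x xs)
    Draws≤-uniform []      = ret
    Draws≤-uniform (_ ∷ _) = toss λ _ → ret

-- Towers of twos

-- The tower starts at 2 rather than 1 because log^ k (fromℕ n) ≤ 1# must exclude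
-- n ≥ tower k: iterating a ≤ log (2^a) from n ≥ tower k ends in 2 ≤ 1.
tower : ℕ → ℕ
tower zero    = 2
tower (suc j) = 2 ℕ.^ tower j

-- Scale 0 is the bucket of the negligible masses, which stays in place when
-- a new heaviest scale is inserted as scale 1.
shift : ∀ {T} → Fin (suc T) → Fin (suc (suc T))
shift zero    = zero
shift (suc t) = suc (suc t)

-- The number of proper scales in a level that is followed by j more levels and the
-- last one; masses below 2^-(cutoff t j) are negligible.  The summand 2t + 3 is
-- large enough for the recursion in cutoff-suc to close at every height of the
-- tower.
cutoff : ℕ → ℕ → ℕ
cutoff t j = tower j ℕ.+ (t ℕ.+ (t ℕ.+ 3))

suc≤2^ : ∀ t → suc t ℕ.≤ 2 ℕ.^ t
suc≤2^ zero    = ℕₚ.≤-refl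
suc≤2^ (suc t) = ℕₚ.≤-trans
  (ℕₚ.≤-reflexive (ℕₚ.+-comm 1 (suc t)))
  (ℕₚ.+-mono-≤ (suc≤2^ t) (ℕₚ.≤-trans (ℕₚ.≤-trans (s≤s z≤n) (suc≤2^ t)) (ℕₚ.m≤m+n _ 0)))

-- With at most suc (cutoff t (suc j)) blocks, each of mass at most
-- 2^-(cutoff t j), the negligible blocks of a level weigh at most 2^-t together.
cutoff-suc : ∀ t j → suc (cutoff t (suc j)) ℕ.* 2 ℕ.^ t ℕ.≤ 2 ℕ.^ cutoff t j
cutoff-suc t j = begin
  suc (W ℕ.+ (t ℕ.+ (t ℕ.+ 3))) ℕ.* 2 ℕ.^ t
    ≤⟨ ℕₚ.*-monoˡ-≤ (2 ℕ.^ t) bound ⟩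
  W ℕ.* 2 ℕ.^ (t ℕ.+ 3) ℕ.* 2 ℕ.^ t
    ≡⟨ ℕₚ.*-assoc W _ _ ⟩
  W ℕ.* (2 ℕ.^ (t ℕ.+ 3) ℕ.* 2 ℕ.^ t)
    ≡⟨ ≡.cong (W ℕ.*_) (ℕₚ.*-comm (2 ℕ.^ (t ℕ.+ 3)) _) ⟩
  W ℕ.* (2 ℕ.^ t ℕ.* 2 ℕ.^ (t ℕ.+ 3))
    ≡⟨ ≡.cong (W ℕ.*_) (ℕₚ.^-distribˡ-+-* 2 t (t ℕ.+ 3)) ⟨
  W ℕ.* 2 ℕ.^ (t ℕ.+ (t ℕ.+ 3))
    ≡⟨ ℕₚ.^-distribˡ-+-* 2 (tower j) _ ⟨
  2 ℕ.^ cutoff t j ∎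
  where
  open ℕₚ.≤-Reasoning
  W r X : ℕ
  W = 2 ℕ.^ tower j
  r = t ℕ.+ (t ℕ.+ 3)
  X = 2 ℕ.^ (t ℕ.+ 3)
  instance
    W≢0 : ℕ.NonZero W
    W≢0 = ℕₚ.m^n≢0 2 (tower j)
  2+r≤X : suc (suc r) ℕ.≤ X
  2+r≤X = begin
    2 ℕ.+ (t ℕ.+ (t ℕ.+ 3))  ≤⟨ lemma ⟩
    suc t ℕ.* 8              ≤⟨ ℕₚ.*-monoˡ-≤ 8 (suc≤2^ t) ⟩
    2 ℕ.^ t ℕ.* 8            ≡⟨ ℕₚ.^-distribˡ-+-* 2 t 3 ⟨
    X                        ∎
    where
    lemma : 2 ℕ.+ (t ℕ.+ (t ℕ.+ 3)) ℕ.≤ suc t ℕ.* 8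
    lemma = begin
      2 ℕ.+ (t ℕ.+ (t ℕ.+ 3))              ≤⟨ ℕₚ.m≤m+n _ (3 ℕ.+ t ℕ.* 6) ⟩
      2 ℕ.+ (t ℕ.+ (t ℕ.+ 3)) ℕ.+ (3 ℕ.+ t ℕ.* 6)
        ≡⟨ NS.solve 1 (λ t → NS.con 2 NS.:+ (t NS.:+ (t NS.:+ NS.con 3)) NS.:+ (NS.con 3 NS.:+ t NS.:* NS.con 6)
             NS.:= (NS.con 1 NS.:+ t) NS.:* NS.con 8) ≡.refl t ⟩
      suc t ℕ.* 8 ∎
      where module NS = Data.Nat.Solver.+-*-Solver
  bound : suc (W ℕ.+ r) ℕ.≤ W ℕ.* X
  bound = begin
    suc (W ℕ.+ r)          ≡⟨ ℕₚ.+-suc W r ⟨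
    W ℕ.+ suc r            ≤⟨ ℕₚ.+-monoʳ-≤ W (ℕₚ.m≤n*m (suc r) W) ⟩
    W ℕ.+ W ℕ.* suc r      ≡⟨ ℕₚ.*-suc W (suc r) ⟨
    W ℕ.* suc (suc r)      ≤⟨ ℕₚ.*-monoʳ-≤ W 2+r≤X ⟩
    W ℕ.* X                ∎

-- The number of trials

-- There are K + 1 levels, e is at least 1/ε and 2^m is at least 1/δ.  Negligible
-- blocks cost at most 2^-w per level.  C is at least 2 and bounds the number of
-- blocks in the last level, so it bounds the imbalance of every bucket, and 1/G is
-- a lower bound for the mean absolute gap against a distant distribution.
module Parameters (K e m : ℕ) where
  w t C G H Q N draws : ℕ
  w = suc K ℕ.* e
  t = suc w
  C = suc (cutoff t 0)
  G = 4 ℕ.* (C ℕ.* w)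
  H = G ℕ.* G
  Q = 8 ℕ.* (H ℕ.* H)
  N = Q ℕ.* (m ℕ.+ m)
  draws = N ℕ.* 3

module Testing (ℝ : CompleteOrderedField) where

  open Reals ℝ
  open CommutativeRing commutativeRing using (refl; sym; trans; reflexive; +-cong; +-congˡ; +-congʳ;
    *-cong; *-congˡ; *-congʳ; +-identityˡ; +-identityʳ; *-identityˡ; *-identityʳ;
    +-assoc; +-comm; *-assoc; *-comm; zeroˡ; zeroʳ; distribˡ; distribʳ; -‿cong; -‿inverseʳ)
  open Algebra.Properties.Ring ring using (-‿distribˡ-*; -‿distribʳ-*; -‿involutive; -‿+-comm; -0#≈0#)
  open Algebra.Properties.Semiring.Mult semiring using (×-homo-+; ×1-homo-*)
  private
    module T = Algebra.Properties.Semiring.Mult.TCOptimised semiring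
  open Algebra.Properties.Semiring.Exp semiring using (^-homo-*; ^-assocʳ)
  open Algebra.Properties.Semiring.Sum semiring
    using (sum-cong-≋; *-distribˡ-sum; *-distribʳ-sum; ∑-distrib-+; ∑-comm; sum-replicate-zero)

  -- Ring identities with integer coefficients

  module ≈-Reasoning = Relation.Binary.Reasoning.Setoid setoid

  private
    -- With the optimised multiplication the literal 1 denotes 1# itself and not
    -- 1# + 0#, so that goals need no preparation before they are passed to the solver.
    ⟦_⟧ℤ : ℤ → Carrier
    ⟦ ℤ.+ n ⟧ℤ      = n T.× 1#
    ⟦ ℤ.-[1+ n ] ⟧ℤ = - (suc n T.× 1#)

    ⟦⊖⟧ : ∀ m n → ⟦ m ℤ.⊖ n ⟧ℤ ≈ m T.× 1# - n T.× 1#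
    ⟦⊖⟧ zero    zero    = sym (-‿inverseʳ 0#)
    ⟦⊖⟧ zero    (suc n) = sym (+-identityˡ _)
    ⟦⊖⟧ (suc m) zero    = sym (trans (+-congˡ -0#≈0#) (+-identityʳ _))
    ⟦⊖⟧ (suc m) (suc n) = begin
      ⟦ suc m ℤ.⊖ suc n ⟧ℤ                   ≡⟨ ≡.cong ⟦_⟧ℤ (ℤₚ.[1+m]⊖[1+n]≡m⊖n m n) ⟩
      ⟦ m ℤ.⊖ n ⟧ℤ                           ≈⟨ ⟦⊖⟧ m n ⟩
      m T.× 1# - n T.× 1#                    ≈⟨ +-congʳ (trans (+-congʳ (-‿inverseʳ 1#)) (+-identityˡ _)) ⟨
      1# - 1# + m T.× 1# - n T.× 1#          ≈⟨ +-congʳ (trans (+-assoc _ _ _) (+-congˡ (+-comm _ _))) ⟩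
      1# + (m T.× 1# - 1#) - n T.× 1#        ≈⟨ +-congʳ (+-assoc _ _ _) ⟨
      1# + m T.× 1# - 1# - n T.× 1#          ≈⟨ +-assoc _ _ _ ⟩
      1# + m T.× 1# + (- 1# - n T.× 1#)      ≈⟨ +-congˡ (-‿+-comm _ _) ⟩
      1# + m T.× 1# - (1# + n T.× 1#)        ≈⟨ +-cong (T.1+× m 1#) (-‿cong (T.1+× n 1#)) ⟨
      suc m T.× 1# - suc n T.× 1#            ∎
      where open ≈-Reasoning

    ⟦⟧-neg : ∀ i → ⟦ ℤ.- i ⟧ℤ ≈ - ⟦ i ⟧ℤ
    ⟦⟧-neg (ℤ.+ zero)    = sym -0#≈0#
    ⟦⟧-neg (ℤ.+ suc n)   = refl
    ⟦⟧-neg ℤ.-[1+ n ]    = sym (-‿involutive _)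

    ⟦⟧-+ : ∀ i j → ⟦ i ℤ.+ j ⟧ℤ ≈ ⟦ i ⟧ℤ + ⟦ j ⟧ℤ
    ⟦⟧-+ (ℤ.+ m)    (ℤ.+ n)    = T.×-homo-+ 1# m n
    ⟦⟧-+ (ℤ.+ m)    ℤ.-[1+ n ] = ⟦⊖⟧ m (suc n)
    ⟦⟧-+ ℤ.-[1+ m ] (ℤ.+ n)    = trans (⟦⊖⟧ n (suc m)) (+-comm _ _)
    ⟦⟧-+ ℤ.-[1+ m ] ℤ.-[1+ n ] = begin
      - (suc (suc (m ℕ.+ n)) T.× 1#)          ≡⟨ ≡.cong (λ k → - (suc k T.× 1#)) (ℕₚ.+-suc m n) ⟨
      - ((suc m ℕ.+ suc n) T.× 1#)            ≈⟨ -‿cong (T.×-homo-+ 1# (suc m) (suc n)) ⟩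
      - (suc m T.× 1# + suc n T.× 1#)         ≈⟨ -‿+-comm _ _ ⟨
      - (suc m T.× 1#) - suc n T.× 1#         ∎
      where open ≈-Reasoning

    ⟦⟧-*-pos : ∀ m n → ⟦ ℤ.+ m ℤ.* ℤ.+ n ⟧ℤ ≈ m T.× 1# * n T.× 1#
    ⟦⟧-*-pos m n = trans (reflexive (≡.cong ⟦_⟧ℤ (≡.sym (ℤₚ.pos-* m n)))) (T.×1-homo-* m n)

    ⟦⟧-* : ∀ i j → ⟦ i ℤ.* j ⟧ℤ ≈ ⟦ i ⟧ℤ * ⟦ j ⟧ℤ
    ⟦⟧-* (ℤ.+ m)    (ℤ.+ n)    = ⟦⟧-*-pos m n
    ⟦⟧-* (ℤ.+ m)    ℤ.-[1+ n ] = begin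
      ⟦ ℤ.+ m ℤ.* (ℤ.- ℤ.+ suc n) ⟧ℤ    ≡⟨ ≡.cong ⟦_⟧ℤ (ℤₚ.neg-distribʳ-* (ℤ.+ m) (ℤ.+ suc n)) ⟨
      ⟦ ℤ.- (ℤ.+ m ℤ.* ℤ.+ suc n) ⟧ℤ    ≈⟨ ⟦⟧-neg (ℤ.+ m ℤ.* ℤ.+ suc n) ⟩
      - ⟦ ℤ.+ m ℤ.* ℤ.+ suc n ⟧ℤ        ≈⟨ -‿cong (⟦⟧-*-pos m (suc n)) ⟩
      - (m T.× 1# * suc n T.× 1#)       ≈⟨ -‿distribʳ-* _ _ ⟩
      m T.× 1# * - (suc n T.× 1#)       ∎
      where open ≈-Reasoning
    ⟦⟧-* ℤ.-[1+ m ] (ℤ.+ n)    = begin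
      ⟦ (ℤ.- ℤ.+ suc m) ℤ.* ℤ.+ n ⟧ℤ    ≡⟨ ≡.cong ⟦_⟧ℤ (ℤₚ.neg-distribˡ-* (ℤ.+ suc m) (ℤ.+ n)) ⟨
      ⟦ ℤ.- (ℤ.+ suc m ℤ.* ℤ.+ n) ⟧ℤ    ≈⟨ ⟦⟧-neg (ℤ.+ suc m ℤ.* ℤ.+ n) ⟩
      - ⟦ ℤ.+ suc m ℤ.* ℤ.+ n ⟧ℤ        ≈⟨ -‿cong (⟦⟧-*-pos (suc m) n) ⟩
      - (suc m T.× 1# * n T.× 1#)       ≈⟨ -‿distribˡ-* _ _ ⟩
      - (suc m T.× 1#) * n T.× 1#       ∎
      where open ≈-Reasoning
    ⟦⟧-* ℤ.-[1+ m ] ℤ.-[1+ n ] = begin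
      ⟦ ℤ.+ suc m ℤ.* ℤ.+ suc n ⟧ℤ          ≈⟨ ⟦⟧-*-pos (suc m) (suc n) ⟩
      suc m T.× 1# * suc n T.× 1#           ≈⟨ -‿involutive _ ⟨
      - - (suc m T.× 1# * suc n T.× 1#)     ≈⟨ -‿cong (-‿distribˡ-* _ _) ⟩
      - (- (suc m T.× 1#) * suc n T.× 1#)   ≈⟨ -‿distribʳ-* _ _ ⟩
      - (suc m T.× 1#) * - (suc n T.× 1#)   ∎
      where open ≈-Reasoning

    ℤ-rawRing : RawRing _ _
    ℤ-rawRing = record
      { Carrier = ℤ ; _≈_ = _≡_ ; _+_ = ℤ._+_ ; _*_ = ℤ._*_ ; -_ = ℤ.-_ ; 0# = ℤ.0ℤ ; 1# = ℤ.1ℤ }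

    ℤ⟶ℝ : ℤ-rawRing -Raw-AlmostCommutative⟶ fromCommutativeRing commutativeRing
    ℤ⟶ℝ = record
      { ⟦_⟧ = ⟦_⟧ℤ ; +-homo = ⟦⟧-+ ; *-homo = ⟦⟧-* ; -‿homo = ⟦⟧-neg ; 0-homo = refl ; 1-homo = refl }

    _≟ℤ_ : ∀ i j → Maybe (⟦ i ⟧ℤ ≈ ⟦ j ⟧ℤ)
    i ≟ℤ j with i ℤₚ.≟ j
    ... | yes ≡.refl = just refl
    ... | no  _      = nothing

  module Solver = Algebra.Solver.Ring ℤ-rawRing (fromCommutativeRing commutativeRing) ℤ⟶ℝ _≟ℤ_

  -- Order

  posetℝ : Poset _ _ _
  posetℝ = record { isPartialOrder = IsDecTotalOrder.isPartialOrder isDecTotalOrder }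

  module ≤-Reasoning = Relation.Binary.Reasoning.PartialOrder posetℝ

  open Solver using (solve; _:=_; _:+_; _:*_; _:-_; :-_; con)

  nil one two : ∀ {k} → Solver.Polynomial k
  nil = con ℤ.0ℤ
  one = con ℤ.1ℤ
  two = one :+ one

  ≤-respʳ : ∀ {x y z} → y ≈ z → x ≤ y → x ≤ z
  ≤-respʳ y≈z x≤y = ≤-trans x≤y (≤-reflexive y≈z)

  ≤-respˡ : ∀ {x y z} → x ≈ y → x ≤ z → y ≤ z
  ≤-respˡ x≈y x≤z = ≤-trans (≤-reflexive (sym x≈y)) x≤z

  ≰⇒≥ : ∀ {x y} → ¬ (x ≤ y) → y ≤ x
  ≰⇒≥ {x} {y} x≰y with total x y
  ... | inj₁ x≤y = contradiction x≤y x≰y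
  ... | inj₂ y≤x = y≤x

  ≮⇒≥ : ∀ {x y} → ¬ (x < y) → y ≤ x
  ≮⇒≥ {x} {y} x≮y with total x y
  ... | inj₂ y≤x = y≤x
  ... | inj₁ x≤y with x ≟ y
  ...   | yes x≈y = ≤-reflexive (sym x≈y)
  ...   | no  x≉y = contradiction (x≤y , x≉y) x≮y

  +-mono-≤ : ∀ {w x y z} → w ≤ x → y ≤ z → w + y ≤ x + z
  +-mono-≤ {_} {x} {y} {z} w≤x y≤z = ≤-trans (+-monoˡ-≤ y w≤x)
    (≤-respˡ (+-comm _ _) (≤-respʳ (+-comm _ _) (+-monoˡ-≤ x y≤z)))

  x≤y⇒0≤y-x : ∀ {x y} → x ≤ y → 0# ≤ y - x
  x≤y⇒0≤y-x {x} x≤y = ≤-respˡ (-‿inverseʳ x) (+-monoˡ-≤ (- x) x≤y)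

  0≤y-x⇒x≤y : ∀ {x y} → 0# ≤ y - x → x ≤ y
  0≤y-x⇒x≤y {x} {y} p = ≤-respˡ (+-identityˡ x)
    (≤-respʳ (solve 2 (λ x y → y :- x :+ x := y) refl x y) (+-monoˡ-≤ x p))

  -- Reduces a polynomial inequality to a visibly nonnegative difference, which the
  -- ring solver checks.
  ≤-by : ∀ {x y} z → 0# ≤ z → y - x ≈ z → x ≤ y
  ≤-by z 0≤z eq = 0≤y-x⇒x≤y (≤-respʳ (sym eq) 0≤z)

  +-nonneg : ∀ {x y} → 0# ≤ x → 0# ≤ y → 0# ≤ x + y
  +-nonneg p q = ≤-respˡ (+-identityˡ 0#) (+-mono-≤ p q)

  neg-mono-≤ : ∀ {x y} → x ≤ y → - y ≤ - x
  neg-mono-≤ {x} {y} x≤y = ≤-by (y - x) (x≤y⇒0≤y-x x≤y)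
    (solve 2 (λ x y → :- x :- :- y := y :- x) refl x y)

  *-monoˡ-≤ : ∀ {x y z} → 0# ≤ z → x ≤ y → z * x ≤ z * y
  *-monoˡ-≤ {x} {y} {z} 0≤z x≤y = ≤-by (z * (y - x)) (*-nonneg 0≤z (x≤y⇒0≤y-x x≤y))
    (solve 3 (λ x y z → z :* y :- z :* x := z :* (y :- x)) refl x y z)

  *-monoʳ-≤ : ∀ {x y z} → 0# ≤ z → x ≤ y → x * z ≤ y * z
  *-monoʳ-≤ {x} {y} {z} 0≤z x≤y =
    ≤-respˡ (*-comm z x) (≤-respʳ (*-comm z y) (*-monoˡ-≤ 0≤z x≤y))

  *-mono-≤ : ∀ {w x y z} → 0# ≤ y → 0# ≤ x → w ≤ x → y ≤ z → w * y ≤ x * z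
  *-mono-≤ 0≤y 0≤x w≤x y≤z = ≤-trans (*-monoʳ-≤ 0≤y w≤x) (*-monoˡ-≤ 0≤x y≤z)

  0≤x² : ∀ x → 0# ≤ x * x
  0≤x² x with total 0# x
  ... | inj₁ p = *-nonneg p p
  ... | inj₂ p = ≤-respʳ (solve 1 (λ x → (con ℤ.0ℤ :- x) :* (con ℤ.0ℤ :- x) := x :* x) refl x)
    (*-nonneg (x≤y⇒0≤y-x p) (x≤y⇒0≤y-x p))

  0≤1 : 0# ≤ 1#
  0≤1 = ≤-respʳ (*-identityˡ 1#) (0≤x² 1#)

  0≤2 : 0# ≤ 2#
  0≤2 = +-nonneg 0≤1 0≤1

  0<1 : 0# < 1#
  0<1 = 0≤1 , λ e → 1≉0 (sym e)

  <-≤-trans : ∀ {x y z} → x < y → y ≤ z → x < z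
  <-≤-trans (x≤y , x≉y) y≤z = ≤-trans x≤y y≤z ,
    λ x≈z → x≉y (antisym x≤y (≤-respʳ (sym x≈z) y≤z))

  <⇒≱ : ∀ {x y} → x < y → ¬ (y ≤ x)
  <⇒≱ (x≤y , x≉y) y≤x = x≉y (antisym x≤y y≤x)

  ≰⇒> : ∀ {x y} → ¬ (x ≤ y) → y < x
  ≰⇒> x≰y = ≰⇒≥ x≰y , λ y≈x → x≰y (≤-reflexive (sym y≈x))

  0<2 : 0# < 2#
  0<2 = <-≤-trans 0<1 (≤-by 1# 0≤1 (solve 0 (two :- one := one) refl))

  ⁻¹-inverse : ∀ {x} → 0# < x → x * x ⁻¹ ≈ 1#
  ⁻¹-inverse (_ , 0≉x) = ⁻¹-inverseʳ _ (λ x≈0 → 0≉x (sym x≈0))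

  0≤⁻¹ : ∀ {x} → 0# < x → 0# ≤ x ⁻¹
  0≤⁻¹ {x} 0<x with total 0# (x ⁻¹)
  ... | inj₁ p = p
  ... | inj₂ p = contradiction
    (≤-respˡ (⁻¹-inverse 0<x) (≤-respʳ (zeroʳ x) (*-monoˡ-≤ (proj₁ 0<x) p))) (<⇒≱ 0<1)

  *-cancelˡ-≤ : ∀ {x y z} → 0# < z → z * x ≤ z * y → x ≤ y
  *-cancelˡ-≤ {x} {y} {z} 0<z p =
    ≤-respˡ (cancel x) (≤-respʳ (cancel y) (*-monoˡ-≤ (0≤⁻¹ 0<z) p))
    where
    cancel : ∀ w → z ⁻¹ * (z * w) ≈ w
    cancel w = trans (solve 3 (λ i z w → i :* (z :* w) := (z :* i) :* w) refl (z ⁻¹) z w)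
      (trans (*-congʳ (⁻¹-inverse 0<z)) (*-identityˡ w))

  -- Inversion is not assumed to respect the equality of the field, so equations
  -- between quotients are proved by cancelling a common positive factor.
  *-cancelˡ-≈ : ∀ {x y z} → 0# < z → z * x ≈ z * y → x ≈ y
  *-cancelˡ-≈ 0<z eq = antisym (*-cancelˡ-≤ 0<z (≤-reflexive eq)) (*-cancelˡ-≤ 0<z (≤-reflexive (sym eq)))

  0<x*y : ∀ {x y} → 0# < x → 0# < y → 0# < x * y
  0<x*y {x} {y} 0<x 0<y = *-nonneg (proj₁ 0<x) (proj₁ 0<y) , λ 0≈xy →
    <⇒≱ 0<y (*-cancelˡ-≤ 0<x (≤-reflexive (trans (sym 0≈xy) (sym (zeroʳ x)))))

  0≤x⇒x≈0⊎0<x : ∀ {x} → 0# ≤ x → x ≈ 0# ⊎ 0# < x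
  0≤x⇒x≈0⊎0<x {x} 0≤x with 0# ≟ x
  ... | yes 0≈x = inj₁ (sym 0≈x)
  ... | no  0≉x = inj₂ (0≤x , 0≉x)

  -- Absolute values

  abs-≥0 : ∀ {x} → 0# ≤ x → abs x ≈ x
  abs-≥0 {x} 0≤x with 0# ≤? x
  ... | yes _   = refl
  ... | no  0≰x = contradiction 0≤x 0≰x

  x≤abs : ∀ x → x ≤ abs x
  x≤abs x with 0# ≤? x
  ... | yes _   = ≤-refl
  ... | no  0≰x = ≤-trans (≰⇒≥ 0≰x) (≤-respˡ -0#≈0# (neg-mono-≤ (≰⇒≥ 0≰x)))

  -x≤abs : ∀ x → - x ≤ abs x
  -x≤abs x with 0# ≤? x
  ... | yes p = ≤-trans (≤-respʳ -0#≈0# (neg-mono-≤ p)) p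
  ... | no  _ = ≤-refl

  0≤abs : ∀ x → 0# ≤ abs x
  0≤abs x with 0# ≤? x
  ... | yes p   = p
  ... | no  0≰x = ≤-respˡ -0#≈0# (neg-mono-≤ (≰⇒≥ 0≰x))

  abs-≤ : ∀ {x y} → x ≤ y → - x ≤ y → abs x ≤ y
  abs-≤ {x} p q with 0# ≤? x
  ... | yes _ = p
  ... | no  _ = q

  abs-cong : ∀ {x y} → x ≈ y → abs x ≈ abs y
  abs-cong {x} {y} x≈y = antisym
    (abs-≤ (≤-respˡ (sym x≈y) (x≤abs y)) (≤-respˡ (-‿cong (sym x≈y)) (-x≤abs y)))
    (abs-≤ (≤-respˡ x≈y (x≤abs x)) (≤-respˡ (-‿cong x≈y) (-x≤abs x)))

  abs-neg : ∀ x → abs (- x) ≈ abs x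
  abs-neg x = antisym
    (abs-≤ (-x≤abs x) (≤-respˡ (sym (-‿involutive x)) (x≤abs x)))
    (abs-≤ (≤-respˡ (-‿involutive x) (-x≤abs (- x))) (x≤abs (- x)))

  abs-+ : ∀ x y → abs (x + y) ≤ abs x + abs y
  abs-+ x y = abs-≤ (+-mono-≤ (x≤abs x) (x≤abs y))
    (≤-respˡ (-‿+-comm x y) (+-mono-≤ (-x≤abs x) (-x≤abs y)))

  abs-*ˡ : ∀ {x} y → 0# ≤ x → abs (x * y) ≈ x * abs y
  abs-*ˡ {x} y 0≤x = antisym
    (abs-≤ (*-monoˡ-≤ 0≤x (x≤abs y))
      (≤-respˡ (sym (-‿distribʳ-* x y)) (*-monoˡ-≤ 0≤x (-x≤abs y))))
    bound
    where
    bound : x * abs y ≤ abs (x * y)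
    bound with 0# ≤? y
    ... | yes _ = x≤abs _
    ... | no  _ = ≤-respˡ (-‿distribʳ-* x y) (-x≤abs _)

  abs² : ∀ x → abs x * abs x ≈ x * x
  abs² x with 0# ≤? x
  ... | yes _ = refl
  ... | no  _ = solve 1 (λ x → :- x :* :- x := x :* x) refl x

  -- Natural numbers and powers

  fromℕ-1 : fromℕ 1 ≈ 1#
  fromℕ-1 = +-identityʳ 1#

  fromℕ-+ : ∀ m n → fromℕ (m ℕ.+ n) ≈ fromℕ m + fromℕ n
  fromℕ-+ = ×-homo-+ 1#

  fromℕ-* : ∀ m n → fromℕ (m ℕ.* n) ≈ fromℕ m * fromℕ n
  fromℕ-* = ×1-homo-*

  0≤fromℕ : ∀ n → 0# ≤ fromℕ n
  0≤fromℕ zero    = ≤-refl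
  0≤fromℕ (suc n) = +-nonneg 0≤1 (0≤fromℕ n)

  1≤fromℕ-suc : ∀ n → 1# ≤ fromℕ (suc n)
  1≤fromℕ-suc n = ≤-respˡ (+-identityʳ 1#) (+-mono-≤ ≤-refl (0≤fromℕ n))

  0<fromℕ-suc : ∀ n → 0# < fromℕ (suc n)
  0<fromℕ-suc n = <-≤-trans 0<1 (1≤fromℕ-suc n)

  fromℕ-mono-≤ : ∀ {m n} → m ℕ.≤ n → fromℕ m ≤ fromℕ n
  fromℕ-mono-≤ {n = n} z≤n = 0≤fromℕ n
  fromℕ-mono-≤ (s≤s p)     = +-mono-≤ ≤-refl (fromℕ-mono-≤ p)

  fromℕ-2^ : ∀ a → fromℕ (2 ℕ.^ a) ≈ 2# ^ a
  fromℕ-2^ zero    = fromℕ-1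
  fromℕ-2^ (suc a) = trans (fromℕ-* 2 (2 ℕ.^ a))
    (*-cong (+-congˡ (+-identityʳ 1#)) (fromℕ-2^ a))

  0≤^ : ∀ {x} → 0# ≤ x → ∀ m → 0# ≤ x ^ m
  0≤^ 0≤x zero    = 0≤1
  0≤^ 0≤x (suc m) = *-nonneg 0≤x (0≤^ 0≤x m)

  0<2^ : ∀ m → 0# < 2# ^ m
  0<2^ zero    = 0<1
  0<2^ (suc m) = 0<x*y 0<2 (0<2^ m)

  -- The induction step loses only the square term m x².
  bernoulli : ∀ {x} → 0# ≤ x → ∀ m → 1# + fromℕ m * x ≤ (1# + x) ^ m
  bernoulli {x} 0≤x zero    = ≤-reflexive (trans (+-congˡ (zeroˡ x)) (+-identityʳ 1#))
  bernoulli {x} 0≤x (suc m) = ≤-trans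
    (≤-by (fromℕ m * (x * x)) (*-nonneg (0≤fromℕ m) (0≤x² x))
      (solve 2 (λ x m → (one :+ x) :* (one :+ m :* x) :- (one :+ (one :+ m) :* x) := m :* (x :* x))
        refl x (fromℕ m)))
    (*-monoˡ-≤ (+-nonneg 0≤1 0≤x) (bernoulli 0≤x m))

  -- Archimedes' axiom alone gives no upper bound on the witness; the least
  -- witness has one.
  ceiling : ∀ x → ∃ λ n → x ≤ fromℕ n × (1# ≤ x → fromℕ n ≤ x + 1#)
  ceiling x with least (λ n → x ≤? fromℕ n) (archimedean x)
  ... | zero  , x≤n , _   = 0 , x≤n , λ 1≤x → ≤-trans 0≤1 (≤-trans 1≤x
        (≤-respˡ (+-identityʳ x) (+-mono-≤ ≤-refl 0≤1)))
  ... | suc n , x≤n , min = suc n , x≤n , λ _ →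
        ≤-respˡ (+-comm _ _) (+-monoˡ-≤ 1# (≰⇒≥ λ x≤n → ℕₚ.<-irrefl ≡.refl (min n x≤n)))

  -- Finite sums

  sum-cong : ∀ {n} {f g : Vector Carrier n} → (∀ i → f i ≈ g i) → sum f ≈ sum g
  sum-cong = sum-cong-≋

  sum-mono-≤ : ∀ {n} {f g : Vector Carrier n} → (∀ i → f i ≤ g i) → sum f ≤ sum g
  sum-mono-≤ {zero}  p = ≤-refl
  sum-mono-≤ {suc n} p = +-mono-≤ (p zero) (sum-mono-≤ (p ∘ suc))

  sum-nonneg : ∀ {n} {f : Vector Carrier n} → (∀ i → 0# ≤ f i) → 0# ≤ sum f
  sum-nonneg {zero}  p = ≤-refl
  sum-nonneg {suc n} p = +-nonneg (p zero) (sum-nonneg (p ∘ suc))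

  term≤sum : ∀ {n} {f : Vector Carrier n} → (∀ i → 0# ≤ f i) → ∀ i → f i ≤ sum f
  term≤sum p zero    = ≤-respˡ (+-identityʳ _) (+-mono-≤ ≤-refl (sum-nonneg (p ∘ suc)))
  term≤sum p (suc i) = ≤-respˡ (+-identityˡ _) (+-mono-≤ (p zero) (term≤sum (p ∘ suc) i))

  sum-const : ∀ n x → sum {n} (λ _ → x) ≈ fromℕ n * x
  sum-const zero    x = sym (zeroˡ x)
  sum-const (suc n) x = trans (+-congˡ (sum-const n x))
    (solve 2 (λ x n → x :+ n :* x := (one :+ n) :* x) refl x (fromℕ n))

  abs-sum : ∀ {n} (f : Vector Carrier n) → abs (sum f) ≤ sum (abs ∘ f)
  abs-sum {zero}  f = ≤-reflexive (abs-≥0 ≤-refl)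
  abs-sum {suc n} f = ≤-trans (abs-+ _ _) (+-mono-≤ ≤-refl (abs-sum (f ∘ suc)))

  -- Indicators

  ⟨_⟩ : Bool → Carrier
  ⟨ true ⟩  = 1#
  ⟨ false ⟩ = 0#

  0≤⟨⟩ : ∀ b → 0# ≤ ⟨ b ⟩
  0≤⟨⟩ true  = 0≤1
  0≤⟨⟩ false = ≤-refl

  ⟨⟩≤1 : ∀ b → ⟨ b ⟩ ≤ 1#
  ⟨⟩≤1 true  = ≤-refl
  ⟨⟩≤1 false = 0≤1

  is : ∀ {n} → Fin n → Fin n → Bool
  is i j = does (i Finₚ.≟ j)

  indicator-≤ : ∀ b {x y} → (b ≡ true → x ≤ y) → ⟨ b ⟩ * x ≤ ⟨ b ⟩ * y
  indicator-≤ true  x≤y = *-monoˡ-≤ 0≤1 (x≤y ≡.refl)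
  indicator-≤ false _   = ≤-reflexive (trans (zeroˡ _) (sym (zeroˡ _)))

  is-true : ∀ {L} (i j : Fin L) → is i j ≡ true → i ≡ j
  is-true i j eq with yes i≡j ← i Finₚ.≟ j = i≡j

  sum-isˡ : ∀ {n} (f : Vector Carrier n) i → ∑[ j < n ] (⟨ is j i ⟩ * f j) ≈ f i
  sum-isˡ {suc n} f zero    = trans (+-cong (*-identityˡ _)
    (trans (sum-cong λ j → zeroˡ (f (suc j))) (sum-replicate-zero n))) (+-identityʳ _)
  sum-isˡ {suc n} f (suc i) = trans (+-cong (zeroˡ _) (sum-isˡ (f ∘ suc) i)) (+-identityˡ _)

  sum-isʳ : ∀ {n} (f : Vector Carrier n) i → ∑[ j < n ] (⟨ is i j ⟩ * f j) ≈ f i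
  sum-isʳ {suc n} f zero    = trans (+-cong (*-identityˡ _)
    (trans (sum-cong λ j → zeroˡ (f (suc j))) (sum-replicate-zero n))) (+-identityʳ _)
  sum-isʳ {suc n} f (suc i) = trans (+-cong (zeroˡ _) (sum-isʳ (f ∘ suc) i)) (+-identityˡ _)

  -- The pushforward of the weights f along c.
  push : ∀ {m n} → (Fin m → Fin n) → Vector Carrier m → Vector Carrier n
  push c f i = ∑[ x < _ ] (⟨ is i (c x) ⟩ * f x)

  push-sum : ∀ {m n} (c : Fin m → Fin n) (f : Vector Carrier m) (φ : Vector Carrier n) →
             ∑[ x < m ] (φ (c x) * f x) ≈ ∑[ i < n ] (φ i * push c f i)
  push-sum {m} {n} c f φ = begin
    ∑[ x < m ] (φ (c x) * f x)
      ≈⟨ sum-cong (λ x → sum-isˡ (λ i → φ i * f x) (c x)) ⟨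
    ∑[ x < m ] ∑[ i < n ] (⟨ is i (c x) ⟩ * (φ i * f x))
      ≈⟨ ∑-comm (λ x i → ⟨ is i (c x) ⟩ * (φ i * f x)) ⟩
    ∑[ i < n ] ∑[ x < m ] (⟨ is i (c x) ⟩ * (φ i * f x))
      ≈⟨ sum-cong (λ i → trans
           (sum-cong λ x → solve 3 (λ a b c → a :* (b :* c) := b :* (a :* c)) refl ⟨ is i (c x) ⟩ (φ i) (f x))
           (sym (*-distribˡ-sum (φ i) λ x → ⟨ is i (c x) ⟩ * f x))) ⟩
    ∑[ i < n ] (φ i * push c f i) ∎
    where open ≈-Reasoning

  push-total : ∀ {m n} (c : Fin m → Fin n) (f : Vector Carrier m) → sum f ≈ sum (push c f)
  push-total c f = trans (sum-cong λ x → sym (*-identityˡ (f x)))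
    (trans (push-sum c f λ _ → 1#) (sum-cong λ i → *-identityˡ (push c f i)))

  push-∘ : ∀ {l m n} (b : Fin m → Fin n) (c : Fin l → Fin m) f i →
           push (b ∘ c) f i ≈ push b (push c f) i
  push-∘ b c f i = push-sum c f (λ j → ⟨ is i (b j) ⟩)

  push-nonneg : ∀ {m n} (c : Fin m → Fin n) {f} → (∀ x → 0# ≤ f x) → ∀ i → 0# ≤ push c f i
  push-nonneg c p i = sum-nonneg λ x → *-nonneg (0≤⟨⟩ (is i (c x))) (p x)

  -- Conditional probabilities

  restrict : ∀ {n} → Distribution n → Subset n → Vector Carrier n
  restrict ν A x = if does (x ∈? A) then prob ν x else 0#

  restrict-nonneg : ∀ {n} (ν : Distribution n) A x → 0# ≤ restrict ν A x
  restrict-nonneg ν A x with does (x ∈? A)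
  ... | true  = prob-≥0 ν x
  ... | false = ≤-refl

  mass-nonneg : ∀ {n} (ν : Distribution n) A → 0# ≤ mass ν A
  mass-nonneg ν A = sum-nonneg (restrict-nonneg ν A)

  conditional-massive : ∀ {n} (ν : Distribution n) A x → 0# < mass ν A →
    conditional ν A x ≡ (if does (x ∈? A) then prob ν x * mass ν A ⁻¹ else 0#)
  conditional-massive ν A x 0<m rewrite dec-true (0# <? mass ν A) 0<m = ≡.refl

  conditional-massless : ∀ {n} (ν : Distribution n) A x → ¬ (0# < mass ν A) →
    conditional ν A x ≡ (if does (x ∈? A) then fromℕ ∣ A ∣ ⁻¹ else 0#)
  conditional-massless ν A x 0≮m rewrite dec-false (0# <? mass ν A) 0≮m = ≡.refl

  -- This form of the multiplication rule is free of division and holds even if A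
  -- has mass 0, since then all its points have probability 0.
  mass*conditional : ∀ {n} (ν : Distribution n) A x →
                     mass ν A * conditional ν A x ≈ restrict ν A x
  mass*conditional ν A x = helper (0# <? mass ν A)
    where
    term : restrict ν A x ≤ mass ν A
    term = term≤sum (restrict-nonneg ν A) x
    helper : Dec (0# < mass ν A) → mass ν A * conditional ν A x ≈ restrict ν A x
    helper (yes 0<m) rewrite conditional-massive ν A x 0<m with does (x ∈? A)
    ... | false = zeroʳ _
    ... | true  = trans (solve 3 (λ m v i → m :* (v :* i) := v :* (m :* i)) refl (mass ν A) _ _)
            (trans (*-congˡ (⁻¹-inverse 0<m)) (*-identityʳ _))
    helper (no 0≮m) = trans (*-congʳ m≈0) (trans (zeroˡ _)
      (antisym (restrict-nonneg ν A x) (≤-respʳ m≈0 term)))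
      where
      m≈0 : mass ν A ≈ 0#
      m≈0 = antisym (≮⇒≥ 0≮m) (mass-nonneg ν A)

  sum-size : ∀ {n} (A : Subset n) y →
             ∑[ x < n ] (if does (x ∈? A) then y else 0#) ≈ fromℕ ∣ A ∣ * y
  sum-size []            y = sym (zeroˡ y)
  sum-size (inside ∷ A)  y = trans (+-congˡ (sum-size A y))
    (solve 2 (λ y n → y :+ n :* y := (one :+ n) :* y) refl y _)
  sum-size (outside ∷ A) y = trans (+-identityˡ _) (sum-size A y)

  0<size : ∀ {n} {A : Subset n} → Nonempty A → 0# < fromℕ ∣ A ∣
  0<size {n} {A} (x , x∈A) = <-≤-trans 0<1
    (≤-respʳ (trans (sum-size A 1#) (*-identityʳ _))
      (≡.subst (λ b → (if b then 1# else 0#) ≤ _) (dec-true (x ∈? A) x∈A)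
        (term≤sum nonneg x)))
    where
    nonneg : ∀ y → 0# ≤ (if does (y ∈? A) then 1# else 0#)
    nonneg y with does (y ∈? A)
    ... | true  = 0≤1
    ... | false = ≤-refl

  sum-conditional : ∀ {n} (ν : Distribution n) {A : Subset n} → Nonempty A →
                    sum (conditional ν A) ≈ 1#
  sum-conditional ν {A} ne = helper (0# <? mass ν A)
    where
    helper : Dec (0# < mass ν A) → sum (conditional ν A) ≈ 1#
    helper (yes 0<m) = *-cancelˡ-≈ 0<m (trans (*-distribˡ-sum _ (conditional ν A))
      (trans (sum-cong (mass*conditional ν A)) (sym (*-identityʳ _))))
    helper (no  0≮m) = trans (sum-cong λ x → reflexive (conditional-massless ν A x 0≮m))
      (trans (sum-size A _) (⁻¹-inverse (0<size ne)))

  conditional-nonneg : ∀ {n} (ν : Distribution n) {A : Subset n} → Nonempty A → ∀ x →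
                       0# ≤ conditional ν A x
  conditional-nonneg ν {A} ne x = helper (0# <? mass ν A)
    where
    helper : Dec (0# < mass ν A) → 0# ≤ conditional ν A x
    helper (yes 0<m) rewrite conditional-massive ν A x 0<m with does (x ∈? A)
    ... | false = ≤-refl
    ... | true  = *-nonneg (prob-≥0 ν x) (0≤⁻¹ 0<m)
    helper (no 0≮m) rewrite conditional-massless ν A x 0≮m with does (x ∈? A)
    ... | false = ≤-refl
    ... | true  = 0≤⁻¹ (0<size ne)

  conditional-cong : ∀ {n} (ν μ : Distribution n) → ν ≐ μ → ∀ A x →
                     conditional ν A x ≈ conditional μ A x
  conditional-cong ν μ ν≐μ A x = helper (0# <? mass μ A)
    where
    restrict-cong : ∀ y → restrict ν A y ≈ restrict μ A y
    restrict-cong y with does (y ∈? A)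
    ... | true  = ν≐μ y
    ... | false = refl
    mν≈mμ : mass ν A ≈ mass μ A
    mν≈mμ = sum-cong restrict-cong
    helper : Dec (0# < mass μ A) → conditional ν A x ≈ conditional μ A x
    helper (yes 0<m) = *-cancelˡ-≈ 0<m (trans (*-congʳ (sym mν≈mμ))
      (trans (mass*conditional ν A x) (trans (restrict-cong x) (sym (mass*conditional μ A x)))))
    helper (no  0≮m) = reflexive (≡.trans
      (conditional-massless ν A x λ 0<mν → 0≮m (<-≤-trans 0<mν (≤-reflexive mν≈mμ)))
      (≡.sym (conditional-massless μ A x 0≮m)))

  does-∈-tabulate : ∀ {n} (s : Fin n → Bool) x → does (x ∈? Vec.tabulate s) ≡ s x
  does-∈-tabulate {suc n} s zero with s zero
  ... | true  = ≡.refl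
  ... | false = ≡.refl
  does-∈-tabulate {suc n} s (suc x) = does-∈-tabulate (s ∘ suc) x

  does-∈-⊤ : ∀ {n} (x : Fin n) → does (x ∈? ⊤) ≡ true
  does-∈-⊤ x = dec-true (x ∈? ⊤) ∈⊤

  conditional-⊤ : ∀ {n} (ν : Distribution n) x → conditional ν ⊤ x ≈ prob ν x
  conditional-⊤ ν x = trans (sym (*-identityˡ _)) (trans (*-congʳ (sym mass-⊤))
    (trans (mass*conditional ν ⊤ x) (restrict-⊤ x)))
    where
    restrict-⊤ : ∀ y → restrict ν ⊤ y ≈ prob ν y
    restrict-⊤ y rewrite does-∈-⊤ y = refl
    mass-⊤ : mass ν ⊤ ≈ 1#
    mass-⊤ = trans (sum-cong restrict-⊤) (prob-sum ν)

  -- Expectations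

  𝔼 : ∀ {n X} → Distribution n → Program n X → (X → Carrier) → Carrier
  𝔼 ν (ret x)      f = f x
  𝔼 ν (toss k T)   f = ∑[ i < suc k ] (fromℕ (suc k) ⁻¹ * 𝔼 ν (T i) f)
  𝔼 ν (draw A _ T) f = ∑[ j < _ ] (conditional ν A j * 𝔼 ν (T j) f)

  sum-uniform : ∀ k → sum {suc k} (λ _ → fromℕ (suc k) ⁻¹) ≈ 1#
  sum-uniform k = trans (sum-const (suc k) _) (⁻¹-inverse (0<fromℕ-suc k))

  weighted-cong : ∀ {m} (w : Vector Carrier m) {f g : Vector Carrier m} → (∀ i → f i ≈ g i) →
    ∑[ i < m ] (w i * f i) ≈ ∑[ i < m ] (w i * g i)
  weighted-cong w p = sum-cong λ i → *-congˡ {w i} (p i)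

  weighted-affine : ∀ {m} (w f : Vector Carrier m) u v → sum w ≈ 1# →
    ∑[ i < m ] (w i * (u + v * f i)) ≈ u + v * ∑[ i < m ] (w i * f i)
  weighted-affine {m} w f u v Σw≈1 = begin
    ∑[ i < m ] (w i * (u + v * f i))
      ≈⟨ sum-cong (λ i → solve 4 (λ w f u v → w :* (u :+ v :* f) := u :* w :+ v :* (w :* f))
           refl (w i) (f i) u v) ⟩
    ∑[ i < m ] (u * w i + v * (w i * f i))
      ≈⟨ ∑-distrib-+ (λ i → u * w i) (λ i → v * (w i * f i)) ⟩
    ∑[ i < m ] (u * w i) + ∑[ i < m ] (v * (w i * f i))
      ≈⟨ +-cong (*-distribˡ-sum u w) (*-distribˡ-sum v λ i → w i * f i) ⟨
    u * sum w + v * ∑[ i < m ] (w i * f i)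
      ≈⟨ +-congʳ (trans (*-congˡ Σw≈1) (*-identityʳ u)) ⟩
    u + v * ∑[ i < m ] (w i * f i) ∎
    where open ≈-Reasoning

  module _ {n} (ν : Distribution n) where

    𝔼-mono : ∀ {X} (t : Program n X) {f g} → (∀ x → f x ≤ g x) → 𝔼 ν t f ≤ 𝔼 ν t g
    𝔼-mono (ret x)       p = p x
    𝔼-mono (toss k T)    p = sum-mono-≤ λ i → *-monoˡ-≤ (0≤⁻¹ (0<fromℕ-suc k)) (𝔼-mono (T i) p)
    𝔼-mono (draw A ne T) p = sum-mono-≤ λ j → *-monoˡ-≤ (conditional-nonneg ν ne j) (𝔼-mono (T j) p)

    𝔼-cong : ∀ {X} (t : Program n X) {f g} → (∀ x → f x ≈ g x) → 𝔼 ν t f ≈ 𝔼 ν t g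
    𝔼-cong t p = antisym (𝔼-mono t (≤-reflexive ∘ p)) (𝔼-mono t (≤-reflexive ∘ sym ∘ p))

    -- Linearity together with the fact that the branch weights sum to 1.  With
    -- monotonicity and the bind rule it carries the analysis of the bets.
    𝔼-affine : ∀ {X} (t : Program n X) u v f → 𝔼 ν t (λ x → u + v * f x) ≈ u + v * 𝔼 ν t f
    𝔼-affine (ret x)       u v f = refl
    𝔼-affine (toss k T)    u v f = trans
      (weighted-cong (λ _ → fromℕ (suc k) ⁻¹) (λ i → 𝔼-affine (T i) u v f))
      (weighted-affine (λ _ → fromℕ (suc k) ⁻¹) (λ i → 𝔼 ν (T i) f) u v (sum-uniform k))
    𝔼-affine (draw A ne T) u v f = trans
      (sum-cong λ j → *-congˡ (𝔼-affine (T j) u v f))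
      (weighted-affine _ (λ j → 𝔼 ν (T j) f) u v (sum-conditional ν ne))

    𝔼-scale : ∀ {X} (t : Program n X) v f → 𝔼 ν t (λ x → v * f x) ≈ v * 𝔼 ν t f
    𝔼-scale t v f = trans (𝔼-cong t λ x → sym (+-identityˡ _))
      (trans (𝔼-affine t 0# v f) (+-identityˡ _))

    𝔼-bind : ∀ {X Y} (t : Program n X) (k : X → Program n Y) f →
             𝔼 ν (t >>= k) f ≈ 𝔼 ν t (λ x → 𝔼 ν (k x) f)
    𝔼-bind (ret x)       k f = refl
    𝔼-bind (toss m T)    k f = weighted-cong (λ _ → fromℕ (suc m) ⁻¹) (λ i → 𝔼-bind (T i) k f)
    𝔼-bind (draw A ne T) k f = sum-cong λ j → *-congˡ (𝔼-bind (T j) k f)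

    Pr-true : ∀ t → Pr ν (toAlgorithm t) true ≈ 𝔼 ν t ⟨_⟩
    Pr-true (ret true)    = refl
    Pr-true (ret false)   = refl
    Pr-true (toss k T)    = weighted-cong (λ _ → fromℕ (suc k) ⁻¹) (λ i → Pr-true (T i))
    Pr-true (draw A ne T) = sum-cong λ j → *-congˡ (Pr-true (T j))

    Pr-false : ∀ t → Pr ν (toAlgorithm t) false ≈ 𝔼 ν t (⟨_⟩ ∘ not)
    Pr-false (ret true)    = refl
    Pr-false (ret false)   = refl
    Pr-false (toss k T)    = weighted-cong (λ _ → fromℕ (suc k) ⁻¹) (λ i → Pr-false (T i))
    Pr-false (draw A ne T) = sum-cong λ j → *-congˡ (Pr-false (T j))

    𝔼-complement : ∀ t → 𝔼 ν t ⟨_⟩ ≈ 1# - 𝔼 ν t (⟨_⟩ ∘ not)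
    𝔼-complement t = trans (𝔼-cong t complement)
      (trans (𝔼-affine t 1# (- 1#) _) (solve 1 (λ x → one :+ :- one :* x := one :- x) refl _))
      where
      complement : ∀ b → ⟨ b ⟩ ≈ 1# + - 1# * ⟨ not b ⟩
      complement true  = solve 0 (one := one :+ :- one :* nil) refl
      complement false = solve 0 (nil := one :+ :- one :* one) refl

  -- Betting

  module Betting {n X} (trial : Program n X) (Z : X → Carrier)
    (-1≤Z : ∀ x → - 1# ≤ Z x) (Z≤1 : ∀ x → Z x ≤ 1#)
    (bar stake : Carrier) (0≤bar : 0# ≤ bar) (0≤stake : 0# ≤ stake) (2stake≤1 : 2# * stake ≤ 1#) where

    -- The wealth W is carried from trial to trial; the final verdict accepts if it
    -- has not passed the bar.
    play : ℕ → Carrier → Program n Bool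
    play zero    W = ret (does (W ≤? bar))
    play (suc N) W = trial >>= λ x → play N (W * (1# + stake * Z x))

    Draws≤-play : ∀ {c} → Draws≤ c trial → ∀ N W → Draws≤ (N ℕ.* c) (play N W)
    Draws≤-play p zero    W = ret
    Draws≤-play p (suc N) W = Draws≤-bind p λ x → Draws≤-play p N _

    -- Since at most half of the wealth is staked, no trial loses more than half.
    0≤1+2y : ∀ x → 0# ≤ 1# + 2# * (stake * Z x)
    0≤1+2y x = ≤-by ((1# - 2# * stake) + 2# * stake * (Z x - - 1#))
      (+-nonneg (x≤y⇒0≤y-x 2stake≤1)
        (*-nonneg (*-nonneg 0≤2 0≤stake) (x≤y⇒0≤y-x (-1≤Z x))))
      (solve 2 (λ s z → one :+ two :* (s :* z) :- nil :=
        (one :- two :* s) :+ two :* s :* (z :- :- one)) refl stake (Z x))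

    0≤1+y : ∀ x → 0# ≤ 1# + stake * Z x
    0≤1+y x = *-cancelˡ-≤ 0<2 (≤-by (1# + (1# + 2# * (stake * Z x))) (+-nonneg 0≤1 (0≤1+2y x))
      (solve 2 (λ s z → two :* (one :+ s :* z) :- two :* nil :=
        one :+ (one :+ two :* (s :* z))) refl stake (Z x)))

    -- Markov's inequality for the final wealth, whose mean is the initial wealth
    -- because the bet is fair.
    fair-bet : ∀ ν → 𝔼 ν trial Z ≈ 0# → ∀ N {W} → 0# ≤ W → bar * 𝔼 ν (play N W) (⟨_⟩ ∘ not) ≤ W
    fair-bet ν EZ≈0 zero {W} 0≤W with W ≤? bar
    ... | yes _   = ≤-respˡ (sym (zeroʳ bar)) 0≤W
    ... | no  W≰b = ≤-respˡ (sym (*-identityʳ bar)) (≰⇒≥ W≰b)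
    fair-bet ν EZ≈0 (suc N) {W} 0≤W = begin
      bar * 𝔼 ν (play (suc N) W) (⟨_⟩ ∘ not)
        ≈⟨ *-congˡ (𝔼-bind ν trial _ _) ⟩
      bar * 𝔼 ν trial (λ x → 𝔼 ν (play N (W * (1# + stake * Z x))) (⟨_⟩ ∘ not))
        ≈⟨ 𝔼-scale ν trial bar _ ⟨
      𝔼 ν trial (λ x → bar * 𝔼 ν (play N (W * (1# + stake * Z x))) (⟨_⟩ ∘ not))
        ≤⟨ 𝔼-mono ν trial (λ x → fair-bet ν EZ≈0 N (*-nonneg 0≤W (0≤1+y x))) ⟩
      𝔼 ν trial (λ x → W * (1# + stake * Z x))
        ≈⟨ trans (𝔼-scale ν trial W _) (*-congˡ (𝔼-affine ν trial 1# stake Z)) ⟩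
      W * (1# + stake * 𝔼 ν trial Z)
        ≈⟨ *-congˡ (trans (+-congˡ (trans (*-congˡ EZ≈0) (zeroʳ stake))) (+-identityʳ 1#)) ⟩
      W * 1#
        ≈⟨ *-identityʳ W ⟩
      W ∎
      where open ≤-Reasoning

    module _ {θ ρ} (0≤ρ : 0# ≤ ρ) (θ≤ρ : 1# + 2# * (stake * stake) - stake * θ ≤ ρ) where

      -- Markov's inequality for the reciprocal 1/W of the final wealth.  A trial
      -- multiplies W by 1 + y with y = stake Z, and for y ≥ -1/2
      --     1 / (1 + y) ≤ 1 - y + 2 y² ≤ 1 + 2 stake² - stake Z,
      -- so the mean of 1/W shrinks by at least the factor ρ.  Multiplying by W keeps the
      -- induction free of division.
      favourable-bet : ∀ ν → θ ≤ 𝔼 ν trial Z → ∀ N {W} → 0# ≤ W →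
                       W * 𝔼 ν (play N W) ⟨_⟩ ≤ bar * ρ ^ N
      favourable-bet ν θ≤EZ zero {W} 0≤W with W ≤? bar
      ... | yes W≤b = *-monoʳ-≤ 0≤1 W≤b
      ... | no  _   = ≤-respˡ (sym (zeroʳ W)) (*-nonneg 0≤bar 0≤1)
      favourable-bet ν θ≤EZ (suc N) {W} 0≤W = begin
        W * 𝔼 ν (play (suc N) W) ⟨_⟩
          ≈⟨ *-congˡ (𝔼-bind ν trial _ _) ⟩
        W * 𝔼 ν trial win
          ≈⟨ 𝔼-scale ν trial W win ⟨
        𝔼 ν trial (λ x → W * win x)
          ≤⟨ 𝔼-mono ν trial step ⟩
        𝔼 ν trial (λ x → B * (1# + 2# * (stake * stake)) + - (B * stake) * Z x)
          ≈⟨ 𝔼-affine ν trial _ _ Z ⟩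
        B * (1# + 2# * (stake * stake)) + - (B * stake) * 𝔼 ν trial Z
          ≤⟨ ≤-by (B * stake * (𝔼 ν trial Z - θ))
               (*-nonneg (*-nonneg 0≤B 0≤stake) (x≤y⇒0≤y-x θ≤EZ))
               (solve 4 (λ b s t e →
                  b :* (one :+ two :* (s :* s) :- s :* t)
                  :- (b :* (one :+ two :* (s :* s)) :+ :- (b :* s) :* e)
                  := b :* s :* (e :- t)) refl B stake θ (𝔼 ν trial Z)) ⟩
        B * (1# + 2# * (stake * stake) - stake * θ)
          ≤⟨ *-monoˡ-≤ 0≤B θ≤ρ ⟩
        B * ρ
          ≈⟨ solve 3 (λ b p r → b :* p :* r := b :* (r :* p)) refl bar (ρ ^ N) ρ ⟩
        bar * ρ ^ suc N ∎
        where
        open ≤-Reasoning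
        B : Carrier
        B = bar * ρ ^ N
        0≤B : 0# ≤ B
        0≤B = *-nonneg 0≤bar (0≤^ 0≤ρ N)
        win : X → Carrier
        win x = 𝔼 ν (play N (W * (1# + stake * Z x))) ⟨_⟩
        0≤win : ∀ x → 0# ≤ win x
        0≤win x = ≤-respˡ (trans (𝔼-scale ν t 0# ⟨_⟩) (zeroˡ _))
          (𝔼-mono ν t λ b → ≤-respˡ (sym (zeroˡ ⟨ b ⟩)) (0≤⟨⟩ b))
          where t = play N (W * (1# + stake * Z x))
        step : ∀ x → W * win x ≤ B * (1# + 2# * (stake * stake)) + - (B * stake) * Z x
        step x = begin
          W * win x
            ≤⟨ ≤-by (W * win x * (y * y * (1# + 2# * y)))
                 (*-nonneg (*-nonneg 0≤W (0≤win x)) (*-nonneg (0≤x² y) (0≤1+2y x)))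
                 (solve 3 (λ w g y → (one :- y :+ two :* (y :* y)) :* (w :* (one :+ y) :* g) :- w :* g
                    := w :* g :* (y :* y :* (one :+ two :* y))) refl W (win x) y) ⟩
          (1# - y + 2# * (y * y)) * (W * (1# + y) * win x)
            ≤⟨ *-monoˡ-≤ 0≤V (favourable-bet ν θ≤EZ N (*-nonneg 0≤W (0≤1+y x))) ⟩
          (1# - y + 2# * (y * y)) * B
            ≤⟨ ≤-by (2# * B * (stake * stake * ((1# - Z x) * (Z x - - 1#))))
                 (*-nonneg (*-nonneg 0≤2 0≤B) (*-nonneg (0≤x² stake)
                   (*-nonneg (x≤y⇒0≤y-x (Z≤1 x)) (x≤y⇒0≤y-x (-1≤Z x)))))
                 (solve 3 (λ b s z →
                    b :* (one :+ two :* (s :* s)) :+ :- (b :* s) :* z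
                    :- (one :- s :* z :+ two :* (s :* z :* (s :* z))) :* b
                    := two :* b :* (s :* s :* ((one :- z) :* (z :- :- one)))) refl B stake (Z x)) ⟩
          B * (1# + 2# * (stake * stake)) + - (B * stake) * Z x ∎
          where
          y : Carrier
          y = stake * Z x
          0≤V : 0# ≤ 1# - y + 2# * (y * y)
          0≤V = *-cancelˡ-≤ 0<2 (≤-by (1# + (1# - y) * (1# - y) + (y * y + 2# * (y * y)))
            (+-nonneg (+-nonneg 0≤1 (0≤x² _)) (+-nonneg (0≤x² y) (*-nonneg 0≤2 (0≤x² y))))
            (solve 1 (λ y → two :* (one :- y :+ two :* (y :* y)) :- two :* nil
              := one :+ (one :- y) :* (one :- y) :+ (y :* y :+ two :* (y :* y))) refl y))

  -- Scores

  rate : ∀ {n} → Distribution n → Subset n → (Fin n → Bool) → Carrier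
  rate ν S A = ∑[ x < _ ] (conditional ν S x * ⟨ A x ⟩)

  rate-cong : ∀ {n} (ν μ : Distribution n) → ν ≐ μ → ∀ S A → rate ν S A ≈ rate μ S A
  rate-cong ν μ ν≐μ S A = sum-cong λ x → *-congʳ (conditional-cong ν μ ν≐μ S x)

  rate-bounds : ∀ {n} (ν : Distribution n) {S} → Nonempty S → ∀ A → 0# ≤ rate ν S A × rate ν S A ≤ 1#
  rate-bounds ν {S} ne A =
    sum-nonneg (λ x → *-nonneg (conditional-nonneg ν ne x) (0≤⟨⟩ (A x))) ,
    ≤-respʳ (sum-conditional ν ne) (sum-mono-≤ λ x →
      ≤-respʳ (*-identityʳ _) (*-monoˡ-≤ (conditional-nonneg ν ne x) (⟨⟩≤1 (A x))))

  -- The random outcome of a trial, from which its score is computed.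
  record Sighting (n : ℕ) : Set where
    constructor sighting
    field
      asked        : Query n
      first second : Fin n

  module _ {n} (μ : Distribution n) where

    interrogate : Program n (Query n) → Program n (Sighting n)
    interrogate pick = pick >>= λ q →
      draw (domain q) (nonempty q) λ x → draw (domain q) (nonempty q) λ y → ret (sighting q x y)

    surprise : Query n → Fin n → Carrier
    surprise q x = rate μ (domain q) (event q) - ⟨ event q x ⟩

    score : Sighting n → Carrier
    score (sighting q x y) = surprise q x * surprise q y

    gap : Distribution n → Query n → Carrier
    gap ν q = rate μ (domain q) (event q) - rate ν (domain q) (event q)

    -- The two samples are independent given the query, so the mean of the product
    -- is the product of the means.
    𝔼-score : ∀ ν pick → 𝔼 ν (interrogate pick) score ≈ 𝔼 ν pick (λ q → gap ν q * gap ν q)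
    𝔼-score ν pick = trans (𝔼-bind ν pick _ score) (𝔼-cong ν pick inner)
      where
      𝔼-surprise : ∀ q → ∑[ x < n ] (conditional ν (domain q) x * surprise q x) ≈ gap ν q
      𝔼-surprise q = trans
        (sum-cong λ x → *-congˡ (+-congˡ (solve 1 (λ a → :- a := :- one :* a) refl ⟨ event q x ⟩)))
        (trans (weighted-affine (conditional ν (domain q)) (λ x → ⟨ event q x ⟩) _ (- 1#)
                 (sum-conditional ν (nonempty q)))
          (+-congˡ (solve 1 (λ a → :- one :* a := :- a) refl _)))
      inner : ∀ q → 𝔼 ν (draw (domain q) (nonempty q) λ x → draw (domain q) (nonempty q) λ y →
                           ret (sighting q x y)) score ≈ gap ν q * gap ν q
      inner q = trans
        (sum-cong λ x → *-congˡ (trans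
          (trans (sum-cong λ y → solve 3 (λ c u v → c :* (u :* v) := u :* (c :* v)) refl
                   (conditional ν (domain q) y) (surprise q x) (surprise q y))
            (sym (*-distribˡ-sum (surprise q x) λ y → conditional ν (domain q) y * surprise q y)))
          (*-congˡ (𝔼-surprise q))))
        (trans (sum-cong λ x → sym (*-assoc (conditional ν (domain q) x) (surprise q x) (gap ν q)))
          (trans (sym (*-distribʳ-sum (gap ν q) λ x → conditional ν (domain q) x * surprise q x))
            (*-congʳ (𝔼-surprise q))))

    surprise-bounds : ∀ q x → - 1# ≤ surprise q x × surprise q x ≤ 1#
    surprise-bounds q x =
      ≤-by (r + (1# - i)) (+-nonneg 0≤r (x≤y⇒0≤y-x (⟨⟩≤1 (event q x))))
        (solve 2 (λ r i → (r :- i) :- :- one := r :+ (one :- i)) refl r i) ,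
      ≤-by (1# - r + i) (+-nonneg (x≤y⇒0≤y-x r≤1) (0≤⟨⟩ (event q x)))
        (solve 2 (λ r i → one :- (r :- i) := one :- r :+ i) refl r i)
      where
      r i : Carrier
      r = rate μ (domain q) (event q)
      i = ⟨ event q x ⟩
      0≤r = proj₁ (rate-bounds μ (nonempty q) (event q))
      r≤1 = proj₂ (rate-bounds μ (nonempty q) (event q))

    score-bounds : ∀ z → - 1# ≤ score z × score z ≤ 1#
    score-bounds (sighting q x y) = lower , upper
      where
      u v : Carrier
      u = surprise q x
      v = surprise q y
      0≤1+ : ∀ x → 0# ≤ surprise q x - - 1#
      0≤1+ x = x≤y⇒0≤y-x (proj₁ (surprise-bounds q x))
      0≤1- : ∀ x → 0# ≤ 1# - surprise q x
      0≤1- x = x≤y⇒0≤y-x (proj₂ (surprise-bounds q x))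
      -- 2 (1 + u v) = (1 + u)(1 + v) + (1 - u)(1 - v), and v ↦ -v gives the upper bound.
      lower : - 1# ≤ u * v
      lower = *-cancelˡ-≤ 0<2 (≤-by ((u - - 1#) * (v - - 1#) + (1# - u) * (1# - v))
        (+-nonneg (*-nonneg (0≤1+ x) (0≤1+ y)) (*-nonneg (0≤1- x) (0≤1- y)))
        (solve 2 (λ u v → two :* (u :* v) :- two :* :- one
          := (u :- :- one) :* (v :- :- one) :+ (one :- u) :* (one :- v)) refl u v))
      upper : u * v ≤ 1#
      upper = *-cancelˡ-≤ 0<2 (≤-by ((u - - 1#) * (1# - v) + (1# - u) * (v - - 1#))
        (+-nonneg (*-nonneg (0≤1+ x) (0≤1- y)) (*-nonneg (0≤1- x) (0≤1+ y)))
        (solve 2 (λ u v → two :* one :- two :* (u :* v)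
          := (u :- :- one) :* (one :- v) :+ (one :- u) :* (v :- :- one)) refl u v))

  -- Uniform choice from a subset

  listSum : ∀ {X : Set} → (X → Carrier) → List X → Carrier
  listSum f = List.foldr (λ x a → f x + a) 0#

  sum-lookup : ∀ {X : Set} (f : X → Carrier) xs → sum (f ∘ lookup xs) ≡ listSum f xs
  sum-lookup f []       = ≡.refl
  sum-lookup f (x ∷ xs) = ≡.cong (f x +_) (sum-lookup f xs)

  listSum-map : ∀ {X Y : Set} (f : Y → Carrier) (g : X → Y) xs →
                listSum f (List.map g xs) ≡ listSum (f ∘ g) xs
  listSum-map f g []       = ≡.refl
  listSum-map f g (x ∷ xs) = ≡.cong (f (g x) +_) (listSum-map f g xs)

  listSum-members : ∀ {L} (s : Fin L → Bool) f → listSum f (members s) ≈ ∑[ i < L ] (⟨ s i ⟩ * f i)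
  listSum-members {zero}  s f = refl
  listSum-members {suc L} s f with s zero
  ... | true  = +-cong (sym (*-identityˡ _))
    (trans (reflexive (listSum-map f suc (members (s ∘ suc)))) (listSum-members (s ∘ suc) (f ∘ suc)))
  ... | false = trans
    (trans (reflexive (listSum-map f suc (members (s ∘ suc)))) (listSum-members (s ∘ suc) (f ∘ suc)))
    (sym (trans (+-congʳ (zeroˡ (f zero))) (+-identityˡ _)))

  listSum-1 : ∀ {X : Set} (xs : List X) → listSum (λ _ → 1#) xs ≡ fromℕ (length xs)
  listSum-1 []       = ≡.refl
  listSum-1 (x ∷ xs) = ≡.cong (1# +_) (listSum-1 xs)

  size : ∀ {L} → (Fin L → Bool) → Carrier
  size {L} s = ∑[ i < L ] ⟨ s i ⟩

  size≤ : ∀ {L} (s : Fin L → Bool) → size s ≤ fromℕ L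
  size≤ {L} s = ≤-respʳ (trans (sum-const L 1#) (*-identityʳ _)) (sum-mono-≤ λ i → ⟨⟩≤1 (s i))

  length-members : ∀ {L} (s : Fin L → Bool) → fromℕ (length (members s)) ≈ size s
  length-members s = trans (reflexive (≡.sym (listSum-1 (members s))))
    (trans (listSum-members s λ _ → 1#) (sum-cong λ i → *-identityʳ ⟨ s i ⟩))

  -- Multiplying by the number of candidates makes the equation hold for the empty
  -- list as well.
  𝔼-uniform : ∀ {n} {X : Set} (ν : Distribution n) (x₀ : X) xs f →
              fromℕ (length xs) * 𝔼 ν (uniform x₀ xs) f ≈ listSum f xs
  𝔼-uniform ν x₀ []        f = zeroˡ _
  𝔼-uniform ν x₀ (x ∷ xs)  f = begin
    N * ∑[ k < _ ] (N ⁻¹ * f (lookup (x ∷ xs) k))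
      ≈⟨ *-congˡ (*-distribˡ-sum (N ⁻¹) (f ∘ lookup (x ∷ xs))) ⟨
    N * (N ⁻¹ * sum (f ∘ lookup (x ∷ xs)))
      ≈⟨ *-assoc _ _ _ ⟨
    N * N ⁻¹ * sum (f ∘ lookup (x ∷ xs))
      ≈⟨ trans (*-congʳ (⁻¹-inverse (0<fromℕ-suc (length xs)))) (*-identityˡ _) ⟩
    sum (f ∘ lookup (x ∷ xs))
      ≡⟨ sum-lookup f (x ∷ xs) ⟩
    listSum f (x ∷ xs) ∎
    where
    open ≈-Reasoning
    N : Carrier
    N = fromℕ (length (x ∷ xs))

  𝔼-uniform-members : ∀ {n L} (ν : Distribution n) i₀ (s : Fin L → Bool) f →
    size s * 𝔼 ν (uniform i₀ (members s)) f ≈ ∑[ i < L ] (⟨ s i ⟩ * f i)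
  𝔼-uniform-members ν i₀ s f = trans (*-congʳ (sym (length-members s)))
    (trans (𝔼-uniform ν i₀ (members s) f) (listSum-members s f))

  -- The distance lost in one bucket

  -- The blocks with s i form the bucket.  The masses p and q are unnormalised, and
  -- P and Q are those of the whole bucket.
  module Bucket {L} (p q : Vector Carrier L) (0≤p : ∀ i → 0# ≤ p i) (0≤q : ∀ i → 0# ≤ q i)
                (s : Fin L → Bool) where

    P Q dev : Carrier
    P   = ∑[ i < L ] (⟨ s i ⟩ * p i)
    Q   = ∑[ i < L ] (⟨ s i ⟩ * q i)
    dev = ∑[ i < L ] (⟨ s i ⟩ * abs (p i - q i))

    0≤P : 0# ≤ P
    0≤P = sum-nonneg λ i → *-nonneg (0≤⟨⟩ (s i)) (0≤p i)

    -- A bucket that is light under μ loses little even if it is heavy under μ′: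
    -- then the difference of the bucket masses already accounts for most of it.
    dev-≤-2P : dev ≤ abs (P - Q) + 2# * P
    dev-≤-2P = begin
      dev
        ≤⟨ sum-mono-≤ (λ i → *-monoˡ-≤ (0≤⟨⟩ (s i)) (abs-≤ {p i - q i} {p i + q i}
             (≤-by (2# * q i) (*-nonneg 0≤2 (0≤q i))
               (solve 2 (λ p q → p :+ q :- (p :- q) := two :* q) refl (p i) (q i)))
             (≤-by (2# * p i) (*-nonneg 0≤2 (0≤p i))
               (solve 2 (λ p q → p :+ q :- :- (p :- q) := two :* p) refl (p i) (q i))))) ⟩
      ∑[ i < L ] (⟨ s i ⟩ * (p i + q i))
        ≈⟨ trans (sum-cong λ i → distribˡ ⟨ s i ⟩ (p i) (q i))
             (∑-distrib-+ (λ i → ⟨ s i ⟩ * p i) (λ i → ⟨ s i ⟩ * q i)) ⟩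
      P + Q
        ≈⟨ solve 2 (λ p q → p :+ q := :- (p :- q) :+ two :* p) refl P Q ⟩
      - (P - Q) + 2# * P
        ≤⟨ +-mono-≤ (-x≤abs (P - Q)) ≤-refl ⟩
      abs (P - Q) + 2# * P ∎
      where open ≤-Reasoning

    cross : Fin L → Fin L → Carrier
    cross i j = abs (p i * q j - q i * p j)

    -- Triangle inequality for
    --     P (pᵢ - qᵢ) = pᵢ (P - Q) + (pᵢ Q - qᵢ P),
    -- where pᵢ Q - qᵢ P is the sum of pᵢ qⱼ - qᵢ pⱼ over the blocks j of the bucket.
    P*dev-≤ : P * dev ≤ P * abs (P - Q) + ∑[ i < L ] (⟨ s i ⟩ * ∑[ j < L ] (⟨ s j ⟩ * cross i j))
    P*dev-≤ = begin
      P * dev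
        ≈⟨ *-distribˡ-sum P (λ i → ⟨ s i ⟩ * abs (p i - q i)) ⟩
      ∑[ i < L ] (P * (⟨ s i ⟩ * abs (p i - q i)))
        ≤⟨ sum-mono-≤ (λ i → ≤-respˡ
             (solve 3 (λ P s a → s :* (P :* a) := P :* (s :* a)) refl P ⟨ s i ⟩ (abs (p i - q i)))
             (*-monoˡ-≤ (0≤⟨⟩ (s i)) (term i))) ⟩
      ∑[ i < L ] (⟨ s i ⟩ * (p i * abs (P - Q) + rest i))
        ≈⟨ sum-cong (λ i → solve 4 (λ s p a r → s :* (p :* a :+ r) := s :* p :* a :+ s :* r) refl
             ⟨ s i ⟩ (p i) (abs (P - Q)) (rest i)) ⟩
      ∑[ i < L ] (⟨ s i ⟩ * p i * abs (P - Q) + ⟨ s i ⟩ * rest i)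
        ≈⟨ ∑-distrib-+ (λ i → ⟨ s i ⟩ * p i * abs (P - Q)) (λ i → ⟨ s i ⟩ * rest i) ⟩
      ∑[ i < L ] (⟨ s i ⟩ * p i * abs (P - Q)) + ∑[ i < L ] (⟨ s i ⟩ * rest i)
        ≈⟨ +-congʳ (*-distribʳ-sum (abs (P - Q)) λ i → ⟨ s i ⟩ * p i) ⟨
      P * abs (P - Q) + ∑[ i < L ] (⟨ s i ⟩ * rest i) ∎
      where
      open ≤-Reasoning
      rest : Fin L → Carrier
      rest i = ∑[ j < L ] (⟨ s j ⟩ * cross i j)
      expand : ∀ i → p i * Q - q i * P ≈ ∑[ j < L ] (⟨ s j ⟩ * (p i * q j - q i * p j))
      expand i = trans
        (+-cong (*-distribˡ-sum (p i) λ j → ⟨ s j ⟩ * q j)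
          (trans (solve 2 (λ a b → :- (a :* b) := (:- a) :* b) refl (q i) P)
            (*-distribˡ-sum (- q i) λ j → ⟨ s j ⟩ * p j)))
        (trans (sym (∑-distrib-+ (λ j → p i * (⟨ s j ⟩ * q j)) (λ j → - q i * (⟨ s j ⟩ * p j))))
          (sum-cong λ j → solve 5 (λ pi qi s pj qj →
            pi :* (s :* qj) :+ :- qi :* (s :* pj) := s :* (pi :* qj :- qi :* pj)) refl
            (p i) (q i) ⟨ s j ⟩ (p j) (q j)))
      term : ∀ i → P * abs (p i - q i) ≤ p i * abs (P - Q) + rest i
      term i = begin
        P * abs (p i - q i)
          ≈⟨ abs-*ˡ (p i - q i) 0≤P ⟨
        abs (P * (p i - q i))
          ≈⟨ abs-cong (solve 4 (λ P Q p q → P :* (p :- q) := p :* (P :- Q) :+ (p :* Q :- q :* P))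
               refl P Q (p i) (q i)) ⟩
        abs (p i * (P - Q) + (p i * Q - q i * P))
          ≤⟨ abs-+ _ _ ⟩
        abs (p i * (P - Q)) + abs (p i * Q - q i * P)
          ≈⟨ +-cong (abs-*ˡ (P - Q) (0≤p i)) (abs-cong (expand i)) ⟩
        p i * abs (P - Q) + abs (∑[ j < L ] (⟨ s j ⟩ * (p i * q j - q i * p j)))
          ≤⟨ +-mono-≤ ≤-refl (abs-sum λ j → ⟨ s j ⟩ * (p i * q j - q i * p j)) ⟩
        p i * abs (P - Q) + ∑[ j < L ] abs (⟨ s j ⟩ * (p i * q j - q i * p j))
          ≈⟨ +-congˡ (sum-cong λ j → abs-*ˡ (p i * q j - q i * p j) (0≤⟨⟩ (s j))) ⟩
        p i * abs (P - Q) + rest i ∎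

    -- Here h i j stands for the absolute gap of the query that compares i with j, and
    -- U j for its mean over uniform i in the bucket.  Balanced means that no block
    -- exceeds C times the average mass P / size s.
    module _ (h : Fin L → Fin L → Carrier) (U : Vector Carrier L) (0≤U : ∀ j → 0# ≤ U j)
      (cross-≤ : ∀ i j → cross i j ≤ (p i + p j) * (q i * h j i + q j * h i j))
      (0≤h : ∀ i j → 0# ≤ h i j)
      (U-mean : ∀ j → ⟨ s j ⟩ * (size s * U j) ≈ ⟨ s j ⟩ * ∑[ i < L ] (⟨ s i ⟩ * h i j))
      (p≤1 : ∀ i → p i ≤ 1#)
      {C} (0≤C : 0# ≤ C) (balanced : ∀ i → s i ≡ true → size s * p i ≤ C * P) where

      -- The contribution of the bucket to the mean absolute gap of the level, the
      -- block j having been reached with probability q j.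
      found : Carrier
      found = ∑[ j < L ] (⟨ s j ⟩ * (q j * U j))

      0≤found : 0# ≤ found
      0≤found = sum-nonneg λ j → *-nonneg (0≤⟨⟩ (s j)) (*-nonneg (0≤q j) (0≤U j))

      private
        m : Carrier
        m = size s

        share : Fin L → Fin L → Carrier
        share i j = ⟨ s i ⟩ * (⟨ s j ⟩ * (q i * h j i))

        sum-share : ∑[ i < L ] ∑[ j < L ] share i j ≈ m * found
        sum-share = trans (sum-cong row) (sym (*-distribˡ-sum m λ j → ⟨ s j ⟩ * (q j * U j)))
          where
          row : ∀ i → ∑[ j < L ] share i j ≈ m * (⟨ s i ⟩ * (q i * U i))
          row i = trans
            (trans (sum-cong λ j → solve 4 (λ a b q h → a :* (b :* (q :* h)) := q :* a :* (b :* h)) refl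
                      ⟨ s i ⟩ ⟨ s j ⟩ (q i) (h j i))
              (sym (*-distribˡ-sum (q i * ⟨ s i ⟩) λ j → ⟨ s j ⟩ * h j i)))
            (trans (*-assoc _ _ _) (trans (*-congˡ (sym (U-mean i)))
              (solve 4 (λ q a m u → q :* (a :* (m :* u)) := m :* (a :* (q :* u))) refl
                (q i) ⟨ s i ⟩ m (U i))))

        -- Balance replaces the factor pᵢ + pⱼ of a cross product by 2 C P / size s; the
        -- four cases of membership turn it into an inequality between indicators.
        pair-≤ : ∀ i j → m * (⟨ s i ⟩ * (⟨ s j ⟩ * cross i j)) ≤ 2# * C * P * (share i j + share j i)
        pair-≤ i j with s i in si | s j in sj
        ... | false | false = ≤-reflexive (solve 5 (λ m x k a b → m :* (nil :* (nil :* x)) :=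
                k :* (nil :* (nil :* a) :+ nil :* (nil :* b))) refl m _ (2# * C * P) _ _)
        ... | false | true  = ≤-reflexive (solve 5 (λ m x k a b → m :* (nil :* (one :* x)) :=
                k :* (nil :* (one :* a) :+ one :* (nil :* b))) refl m _ (2# * C * P) _ _)
        ... | true  | false = ≤-reflexive (solve 5 (λ m x k a b → m :* (one :* (nil :* x)) :=
                k :* (one :* (nil :* a) :+ nil :* (one :* b))) refl m _ (2# * C * P) _ _)
        ... | true  | true  = begin
          m * (1# * (1# * cross i j))
            ≈⟨ *-congˡ (trans (*-identityˡ _) (*-identityˡ _)) ⟩
          m * cross i j
            ≤⟨ *-monoˡ-≤ (sum-nonneg (0≤⟨⟩ ∘ s)) (cross-≤ i j) ⟩
          m * ((p i + p j) * w)
            ≈⟨ solve 4 (λ m a b w → m :* ((a :+ b) :* w) := (m :* a :+ m :* b) :* w) refl m (p i) (p j) w ⟩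
          (m * p i + m * p j) * w
            ≤⟨ *-monoʳ-≤ 0≤w (+-mono-≤ (balanced i si) (balanced j sj)) ⟩
          (C * P + C * P) * w
            ≈⟨ solve 4 (λ C P a b → (C :* P :+ C :* P) :* (a :+ b) := two :* C :* P :*
                 (one :* (one :* a) :+ one :* (one :* b))) refl C P (q i * h j i) (q j * h i j) ⟩
          2# * C * P * (1# * (1# * (q i * h j i)) + 1# * (1# * (q j * h i j))) ∎
          where
          open ≤-Reasoning
          w : Carrier
          w = q i * h j i + q j * h i j
          0≤w : 0# ≤ w
          0≤w = +-nonneg (*-nonneg (0≤q i) (0≤h j i)) (*-nonneg (0≤q j) (0≤h i j))

        m*sum-cross-≤ : m * ∑[ i < L ] (⟨ s i ⟩ * ∑[ j < L ] (⟨ s j ⟩ * cross i j)) ≤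
                        2# * C * P * (m * found + m * found)
        m*sum-cross-≤ = begin
          m * ∑[ i < L ] (⟨ s i ⟩ * ∑[ j < L ] (⟨ s j ⟩ * cross i j))
            ≈⟨ trans (*-distribˡ-sum m λ i → ⟨ s i ⟩ * ∑[ j < L ] (⟨ s j ⟩ * cross i j))
                 (sum-cong λ i → trans (sym (*-assoc _ _ _))
                   (trans (*-distribˡ-sum (m * ⟨ s i ⟩) λ j → ⟨ s j ⟩ * cross i j)
                     (sum-cong λ j → *-assoc m ⟨ s i ⟩ (⟨ s j ⟩ * cross i j)))) ⟩
          ∑[ i < L ] ∑[ j < L ] (m * (⟨ s i ⟩ * (⟨ s j ⟩ * cross i j)))
            ≤⟨ sum-mono-≤ (λ i → sum-mono-≤ λ j → pair-≤ i j) ⟩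
          ∑[ i < L ] ∑[ j < L ] (K * (share i j + share j i))
            ≈⟨ trans (sum-cong λ i → sym (*-distribˡ-sum K λ j → share i j + share j i))
                 (sym (*-distribˡ-sum K λ i → ∑[ j < L ] (share i j + share j i))) ⟩
          K * ∑[ i < L ] ∑[ j < L ] (share i j + share j i)
            ≈⟨ *-congˡ (trans (sum-cong λ i → ∑-distrib-+ (share i) (λ j → share j i))
                 (∑-distrib-+ (λ i → ∑[ j < L ] share i j) (λ i → ∑[ j < L ] share j i))) ⟩
          K * (∑[ i < L ] ∑[ j < L ] share i j + ∑[ i < L ] ∑[ j < L ] share j i)
            ≈⟨ *-congˡ (+-cong sum-share (trans (∑-comm (λ i j → share j i)) sum-share)) ⟩
          K * (m * found + m * found) ∎
          where
          open ≤-Reasoning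
          K : Carrier
          K = 2# * C * P

        P≤m : P ≤ m
        P≤m = sum-mono-≤ λ i → ≤-respʳ (*-identityʳ _) (*-monoˡ-≤ (0≤⟨⟩ (s i)) (p≤1 i))

      -- If P > 0 the bounds above may be divided by size s and P.  If P = 0 the
      -- distance is not reduced at all by merging the bucket.
      dev-≤-found : dev ≤ abs (P - Q) + 2# * 2# * C * found
      dev-≤-found with 0≤x⇒x≈0⊎0<x 0≤P
      ... | inj₁ P≈0 = ≤-trans dev-≤-2P (+-mono-≤ ≤-refl
              (≤-respˡ (sym (trans (*-congˡ P≈0) (zeroʳ 2#)))
                (*-nonneg (*-nonneg (*-nonneg 0≤2 0≤2) 0≤C) 0≤found)))
      ... | inj₂ 0<P = *-cancelˡ-≤ (0<x*y (<-≤-trans 0<P P≤m) 0<P) (begin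
        m * P * dev
          ≈⟨ *-assoc m P dev ⟩
        m * (P * dev)
          ≤⟨ *-monoˡ-≤ (≤-trans 0≤P P≤m) P*dev-≤ ⟩
        m * (P * abs (P - Q) + ∑[ i < L ] (⟨ s i ⟩ * ∑[ j < L ] (⟨ s j ⟩ * cross i j)))
          ≈⟨ distribˡ m _ _ ⟩
        m * (P * abs (P - Q)) + m * ∑[ i < L ] (⟨ s i ⟩ * ∑[ j < L ] (⟨ s j ⟩ * cross i j))
          ≤⟨ +-mono-≤ ≤-refl m*sum-cross-≤ ⟩
        m * (P * abs (P - Q)) + 2# * C * P * (m * found + m * found)
          ≈⟨ solve 5 (λ m P a C f → m :* (P :* a) :+ two :* C :* P :* (m :* f :+ m :* f) :=
               m :* P :* (a :+ two :* two :* C :* f)) refl m P (abs (P - Q)) C found ⟩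
        m * P * (abs (P - Q) + 2# * 2# * C * found) ∎)
        where open ≤-Reasoning

  -- The masses of two blocks and of their union

  push-≤1 : ∀ {n L} (ν : Distribution n) (c : Fin n → Fin L) i → push c (prob ν) i ≤ 1#
  push-≤1 ν c i = ≤-respʳ (trans (sym (push-total c (prob ν))) (prob-sum ν))
    (term≤sum (push-nonneg c (prob-≥0 ν)) i)

  module _ {n L} (ν : Distribution n) (c : Fin n → Fin L) where

    private
      w : Vector Carrier L
      w = push c (prob ν)

    mass-pair : ∀ {i j} → i ≢ j → mass ν (pairDomain c i j) ≈ w i + w j
    mass-pair {i} {j} i≢j = trans (sum-cong pointwise)
      (∑-distrib-+ (λ x → ⟨ is i (c x) ⟩ * prob ν x) (λ x → ⟨ is j (c x) ⟩ * prob ν x))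
      where
      pointwise : ∀ x → restrict ν (pairDomain c i j) x ≈
                        ⟨ is i (c x) ⟩ * prob ν x + ⟨ is j (c x) ⟩ * prob ν x
      pointwise x rewrite does-∈-tabulate (λ x → is i (c x) ∨ is j (c x)) x
        with i Finₚ.≟ c x | j Finₚ.≟ c x
      ... | yes i≡ | yes j≡ = contradiction (≡.trans i≡ (≡.sym j≡)) i≢j
      ... | yes _  | no  _  = solve 1 (λ v → v := one :* v :+ nil :* v) refl (prob ν x)
      ... | no  _  | yes _  = solve 1 (λ v → v := nil :* v :+ one :* v) refl (prob ν x)
      ... | no  _  | no  _  = solve 1 (λ v → nil := nil :* v :+ nil :* v) refl (prob ν x)

    mass*rate : ∀ i j → mass ν (pairDomain c i j) * rate ν (pairDomain c i j) (is i ∘ c) ≈ w i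
    mass*rate i j = trans (*-distribˡ-sum _ λ x → conditional ν (pairDomain c i j) x * ⟨ is i (c x) ⟩)
      (sum-cong λ x → trans (sym (*-assoc _ _ _))
        (trans (*-congʳ (mass*conditional ν (pairDomain c i j) x)) (pointwise x)))
      where
      pointwise : ∀ x → restrict ν (pairDomain c i j) x * ⟨ is i (c x) ⟩ ≈ ⟨ is i (c x) ⟩ * prob ν x
      pointwise x rewrite does-∈-tabulate (λ x → is i (c x) ∨ is j (c x)) x with is i (c x)
      ... | true  = *-comm _ _
      ... | false = trans (zeroʳ _) (sym (zeroˡ _))

    -- Two distinct blocks are disjoint, so the mass of the union is the sum of the
    -- masses.  The equation also covers massless pairs.
    pair-rate : ∀ {i j} → i ≢ j → (w i + w j) * rate ν (pairDomain c i j) (is i ∘ c) ≈ w i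
    pair-rate {i} {j} i≢j = trans (*-congʳ (sym (mass-pair i≢j))) (mass*rate i j)

  -- The distance lost in one level

  module Level {n} (x₀ : Fin n) (μ ν : Distribution n) where

    absgap : Query n → Carrier
    absgap q = abs (gap μ ν q)

    distance : ∀ {L} → (Fin n → Fin L) → Carrier
    distance {L} c = ∑[ i < L ] abs (push c (prob μ) i - push c (prob ν) i)

    module _ {L L′} (c : Fin n → Fin L) (b : Fin L → Fin L′) where

      private
        p q : Vector Carrier L
        p = push c (prob μ)
        q = push c (prob ν)

        0≤p : ∀ i → 0# ≤ p i
        0≤p = push-nonneg c (prob-≥0 μ)

        0≤q : ∀ i → 0# ≤ q i
        0≤q = push-nonneg c (prob-≥0 ν)

        -- The absolute gap of a query comparing the blocks i and j; it does not depend on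
        -- which point shows that the domain is nonempty.
        h : Fin L → Fin L → Carrier
        h i j = abs (rate μ (pairDomain c i j) (is i ∘ c) - rate ν (pairDomain c i j) (is i ∘ c))

        0≤h : ∀ i j → 0# ≤ h i j
        0≤h i j = 0≤abs (rate μ (pairDomain c i j) (is i ∘ c) - rate ν (pairDomain c i j) (is i ∘ c))

        sameBucket : Fin L → Fin L → Bool
        sameBucket j i = is (b j) (b i)

        U : Vector Carrier L
        U j = 𝔼 ν (uniform j (members (sameBucket j))) λ i → h i j

        0≤U : ∀ j → 0# ≤ U j
        0≤U j = ≤-respˡ (trans (𝔼-scale ν t 0# (λ i → h i j)) (zeroˡ _))
          (𝔼-mono ν t λ i → ≤-respˡ (sym (zeroˡ (h i j))) (0≤h i j))
          where t = uniform j (members (sameBucket j))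

      𝔼-round : 𝔼 ν (round x₀ c b) absgap ≈ ∑[ j < L ] (q j * U j)
      𝔼-round = trans (sum-cong term) (trans (push-sum c (prob ν) U) (sum-cong λ j → *-comm (U j) (q j)))
        where
        term : ∀ x → conditional ν ⊤ x *
          𝔼 ν (uniform (c x) (members (sameBucket (c x))) >>= λ i → ret (pairQuery c i x)) absgap
          ≈ U (c x) * prob ν x
        term x = trans (*-cong (conditional-⊤ ν x) (𝔼-bind ν (uniform (c x) (members (sameBucket (c x)))) _ absgap))
          (*-comm _ _)

      private
        -- pᵢ qⱼ - qᵢ pⱼ = pᵢ (qᵢ + qⱼ) - qᵢ (pᵢ + pⱼ), and pᵢ and qᵢ are the rates of
        -- block i times pᵢ + pⱼ and qᵢ + qⱼ.
        cross-identity : ∀ {i j} → i ≢ j → abs (p i * q j - q i * p j) ≈ (p i + p j) * (q i + q j) * h i j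
        cross-identity {i} {j} i≢j = trans (abs-cong
          (trans (solve 4 (λ pi pj qi qj → pi :* qj :- qi :* pj := pi :* (qi :+ qj) :- qi :* (pi :+ pj))
                   refl (p i) (p j) (q i) (q j))
            (trans (+-cong (*-congʳ (sym (pair-rate μ c i≢j))) (-‿cong (*-congʳ (sym (pair-rate ν c i≢j)))))
              (solve 4 (λ P a Q a′ → P :* a :* Q :- Q :* a′ :* P := P :* Q :* (a :- a′)) refl
                (p i + p j) _ (q i + q j) _))))
          (abs-*ˡ _ (*-nonneg (+-nonneg (0≤p i) (0≤p j)) (+-nonneg (0≤q i) (0≤q j))))

        -- The tester meets the pair through j only, so the weight qᵢ has to be paired
        -- with the query in which i and j change roles.  Both queries have the same
        -- gap as long as qᵢ + qⱼ > 0 and pᵢ + pⱼ > 0; this is used in the form that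
        -- cross i j is symmetric.
        cross-≤ : ∀ i j → abs (p i * q j - q i * p j) ≤ (p i + p j) * (q i * h j i + q j * h i j)
        cross-≤ i j with i Finₚ.≟ j
        ... | yes ≡.refl = ≤-respˡ
              (sym (trans (abs-cong (solve 2 (λ a b → a :* b :- b :* a := nil) refl (p i) (q i))) (abs-≥0 ≤-refl)))
              (*-nonneg (+-nonneg (0≤p i) (0≤p i))
                (+-nonneg (*-nonneg (0≤q i) (0≤h i i)) (*-nonneg (0≤q i) (0≤h i i))))
        ... | no i≢j = bound (0≤x⇒x≈0⊎0<x 0≤Q)
          where
          T Q : Carrier
          T = abs (p i * q j - q i * p j)
          Q = q i + q j
          0≤Q : 0# ≤ Q
          0≤Q = +-nonneg (0≤q i) (0≤q j)
          T-sym : T ≈ (p i + p j) * Q * h j i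
          T-sym = trans (sym (abs-neg _)) (trans
            (abs-cong (solve 4 (λ pi pj qi qj → :- (pi :* qj :- qi :* pj) := pj :* qi :- qj :* pi) refl
              (p i) (p j) (q i) (q j)))
            (trans (cross-identity (i≢j ∘ ≡.sym)) (*-congʳ (*-cong (+-comm _ _) (+-comm _ _)))))
          bound : Q ≈ 0# ⊎ 0# < Q → T ≤ (p i + p j) * (q i * h j i + q j * h i j)
          bound (inj₁ Q≈0) = ≤-respˡ
            (sym (trans (cross-identity i≢j) (trans (*-congʳ (trans (*-congˡ Q≈0) (zeroʳ _))) (zeroˡ _))))
            (*-nonneg (+-nonneg (0≤p i) (0≤p j))
              (+-nonneg (*-nonneg (0≤q i) (0≤h j i)) (*-nonneg (0≤q j) (0≤h i j))))
          bound (inj₂ 0<Q) = *-cancelˡ-≤ 0<Q (≤-reflexive (begin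
            Q * T
              ≈⟨ distribʳ T (q i) (q j) ⟩
            q i * T + q j * T
              ≈⟨ +-cong (*-congˡ T-sym) (*-congˡ (cross-identity i≢j)) ⟩
            q i * ((p i + p j) * Q * h j i) + q j * ((p i + p j) * Q * h i j)
              ≈⟨ solve 6 (λ a b P Q g h → a :* (P :* Q :* g) :+ b :* (P :* Q :* h) :=
                   Q :* (P :* (a :* g :+ b :* h))) refl (q i) (q j) (p i + p j) Q (h j i) (h i j) ⟩
            Q * ((p i + p j) * (q i * h j i + q j * h i j)) ∎))
            where open ≈-Reasoning

        U-mean : ∀ B j → ⟨ is B (b j) ⟩ * (size (is B ∘ b) * U j) ≈
                         ⟨ is B (b j) ⟩ * ∑[ i < L ] (⟨ is B (b i) ⟩ * h i j)
        U-mean B j with B Finₚ.≟ b j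
        ... | yes ≡.refl = *-congˡ (𝔼-uniform-members ν j (sameBucket j) λ i → h i j)
        ... | no _       = trans (zeroˡ _) (sym (zeroˡ _))

      bucketMass : Fin L′ → Carrier
      bucketMass = push b p

      Balanced : Carrier → Fin L′ → Set
      Balanced C B = ∀ i → is B (b i) ≡ true → size (is B ∘ b) * p i ≤ C * bucketMass B

      private
        deviation excess : Fin L′ → Carrier
        deviation = push b λ i → abs (p i - q i)
        excess B  = abs (push b p B - push b q B)

      -- A bucket may either be balanced, and then its loss is found by the queries, or
      -- be so light that its loss is tolerated.
      distance-≤ : ∀ {C} → 0# ≤ C → (loss : Vector Carrier L′) → (∀ B → 0# ≤ loss B) →
        (∀ B → Balanced C B ⊎ 2# * bucketMass B ≤ loss B) →
        distance c ≤ distance (b ∘ c) + 2# * 2# * C * 𝔼 ν (round x₀ c b) absgap + sum loss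
      distance-≤ {C} 0≤C loss 0≤loss good = begin
        distance c
          ≈⟨ push-total b (λ i → abs (p i - q i)) ⟩
        sum deviation
          ≤⟨ sum-mono-≤ bucket-≤ ⟩
        ∑[ B < L′ ] (excess B + K * found B + loss B)
          ≈⟨ trans (∑-distrib-+ (λ B → excess B + K * found B) loss)
               (+-congʳ (∑-distrib-+ excess (λ B → K * found B))) ⟩
        sum excess + ∑[ B < L′ ] (K * found B) + sum loss
          ≈⟨ +-congʳ (+-cong
               (sum-cong λ B → abs-cong (+-cong (push-∘ b c (prob μ) B) (-‿cong (push-∘ b c (prob ν) B))))
               (trans (*-congˡ (trans 𝔼-round (push-total b λ j → q j * U j))) (*-distribˡ-sum K found))) ⟨
        distance (b ∘ c) + K * 𝔼 ν (round x₀ c b) absgap + sum loss ∎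
        where
        open ≤-Reasoning
        K : Carrier
        K = 2# * 2# * C
        found : Fin L′ → Carrier
        found = push b λ j → q j * U j
        0≤found : ∀ B → 0# ≤ found B
        0≤found = push-nonneg b λ j → *-nonneg (0≤q j) (0≤U j)
        0≤K : 0# ≤ K
        0≤K = *-nonneg (*-nonneg 0≤2 0≤2) 0≤C
        bucket-≤ : ∀ B → deviation B ≤ excess B + K * found B + loss B
        bucket-≤ B with good B
        ... | inj₁ balanced = ≤-trans
              (Bucket.dev-≤-found p q 0≤p 0≤q (is B ∘ b) h U 0≤U cross-≤ 0≤h (U-mean B)
                (push-≤1 μ c) 0≤C balanced)
              (≤-respˡ (+-identityʳ _) (+-mono-≤ ≤-refl (0≤loss B)))
        ... | inj₂ light = ≤-trans (Bucket.dev-≤-2P p q 0≤p 0≤q (is B ∘ b))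
              (+-mono-≤ (≤-respˡ (+-identityʳ _) (+-mono-≤ ≤-refl (*-nonneg 0≤K (0≤found B)))) light)

  -- Scales of mass

  -- The number of doublings, at least one, that bring x up to 1, or zero if this
  -- takes more than T of them.
  scaleOf : ∀ T → Carrier → Fin (suc T)
  scaleOf zero    x = zero
  scaleOf (suc T) x = if does (1# ≤? 2# * x) then suc zero else shift (scaleOf T (2# * x))

  AtScale : ∀ T → Carrier → Fin (suc T) → Set
  AtScale T x zero    = 2# ^ T * x ≤ 1#
  AtScale T x (suc t) = 1# ≤ 2# ^ suc (toℕ t) * x × 2# ^ suc (toℕ t) * x ≤ 2#

  2^suc* : ∀ k x → 2# ^ k * (2# * x) ≈ 2# ^ suc k * x
  2^suc* k x = solve 3 (λ p t x → p :* (t :* x) := t :* p :* x) refl (2# ^ k) 2# x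

  scaleOf-correct : ∀ T {x} → x ≤ 1# → AtScale T x (scaleOf T x)
  scaleOf-correct zero    {x} x≤1 = ≤-respˡ (sym (*-identityˡ x)) x≤1
  scaleOf-correct (suc T) {x} x≤1 = helper (1# ≤? 2# * x)
    where
    2^1*x : 2# * x ≈ 2# ^ 1 * x
    2^1*x = *-congʳ (sym (*-identityʳ 2#))
    deeper : ∀ t → AtScale T (2# * x) t → AtScale (suc T) x (shift t)
    deeper zero    p       = ≤-respˡ (2^suc* T x) p
    deeper (suc t) (p , q) = ≤-respʳ (2^suc* (suc (toℕ t)) x) p , ≤-respˡ (2^suc* (suc (toℕ t)) x) q
    helper : (1≤?2x : Dec (1# ≤ 2# * x)) →
             AtScale (suc T) x (if does 1≤?2x then suc zero else shift (scaleOf T (2# * x)))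
    helper (yes 1≤2x) = ≤-respʳ 2^1*x 1≤2x , ≤-respˡ 2^1*x (≤-respʳ (*-identityʳ 2#) (*-monoˡ-≤ 0≤2 x≤1))
    helper (no  1≰2x) = deeper (scaleOf T (2# * x)) (scaleOf-correct T (≰⇒≥ 1≰2x))

  -- All levels

  module Levels {n} (x₀ : Fin n) (μ : Distribution n) (t : ℕ) where

    rescale : ∀ j {L} → (Fin n → Fin L) → Fin L → Fin (suc (cutoff t j))
    rescale j c i = scaleOf (cutoff t j) (push c (prob μ) i)

    -- All levels in one family, so that a single toss can select the level; the last
    -- one merges all the blocks that are left.
    levels : ∀ j {L} → (Fin n → Fin L) → Fin (suc j) → Program n (Query n)
    levels zero    c _       = round x₀ c λ _ → zero {0}
    levels (suc j) c zero    = round x₀ c (rescale j c)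
    levels (suc j) c (suc k) = levels j (rescale j c ∘ c) k

    Draws≤-levels : ∀ j {L} (c : Fin n → Fin L) k → Draws≤ 1 (levels j c k)
    Draws≤-levels zero    c k       = Draws≤-round x₀ c λ _ → zero {0}
    Draws≤-levels (suc j) c zero    = Draws≤-round x₀ c (rescale j c)
    Draws≤-levels (suc j) c (suc k) = Draws≤-levels j (rescale j c ∘ c) k

    module _ (ν : Distribution n) {η} (0≤η : 0# ≤ η) (2≤2^t*η : 2# ≤ 2# ^ t * η) where
      open Level x₀ μ ν

      C : Carrier
      C = fromℕ (suc (cutoff t 0))

      0≤C : 0# ≤ C
      0≤C = 0≤fromℕ (suc (cutoff t 0))

      2≤C : 2# ≤ C
      2≤C = +-mono-≤ ≤-refl (1≤fromℕ-suc (suc (t ℕ.+ (t ℕ.+ 3))))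

      scaled-bucketMass : ∀ {L L′} (c : Fin n → Fin L) (b : Fin L → Fin L′) B y →
        y * bucketMass c b B ≈ ∑[ i < L ] (⟨ is B (b i) ⟩ * (y * push c (prob μ) i))
      scaled-bucketMass c b B y =
        trans (*-distribˡ-sum y λ i → ⟨ is B (b i) ⟩ * push c (prob μ) i)
          (sum-cong λ i → solve 3 (λ y a p → y :* (a :* p) := a :* (y :* p)) refl y ⟨ is B (b i) ⟩ (push c (prob μ) i))

      -- A single block weighs at most as much as the bucket, so with at most C blocks it
      -- weighs at most C times the average.
      one-bucket : ∀ {L} (c : Fin n → Fin L) → fromℕ L ≤ C →
                   ∀ B → Balanced c (λ _ → zero {0}) C B
      one-bucket {L} c L≤C zero i _ = *-mono-≤ (push-nonneg c (prob-≥0 μ) i) 0≤C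
        (≤-trans (size≤ {L} λ _ → true) L≤C)
        (≤-respˡ (*-identityˡ (push c (prob μ) i)) (term≤sum {f = λ i → 1# * push c (prob μ) i}
          (λ i → *-nonneg 0≤1 (push-nonneg c (prob-≥0 μ) i)) i))

      -- With u = 2^(k+1) every block of the bucket satisfies 1 ≤ u p ≤ 2, so the
      -- heaviest is at most twice, and hence at most C times, the average.
      scale-balanced : ∀ j {L} (c : Fin n → Fin L) k → Balanced c (rescale j c) C (suc k)
      scale-balanced j {L} c k i i∈B = *-cancelˡ-≤ (0<2^ (suc (toℕ k))) (begin
        u * (m * p i)
          ≈⟨ solve 3 (λ u m p → u :* (m :* p) := m :* (u :* p)) refl u m (p i) ⟩
        m * (u * p i)
          ≤⟨ *-mono-≤ (*-nonneg (proj₁ (0<2^ (suc (toℕ k)))) (push-nonneg c (prob-≥0 μ) i))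
               0≤m ≤-refl (≤-trans (proj₂ (scale i i∈B)) 2≤C) ⟩
        m * C
          ≤⟨ *-monoʳ-≤ 0≤C m≤uP ⟩
        u * P * C
          ≈⟨ solve 3 (λ u P C → u :* P :* C := u :* (C :* P)) refl u P C ⟩
        u * (C * P) ∎)
        where
        open ≤-Reasoning
        b : Fin L → Fin (suc (cutoff t j))
        b = rescale j c
        p : Vector Carrier L
        p = push c (prob μ)
        u m P : Carrier
        u = 2# ^ suc (toℕ k)
        m = size (is (suc k) ∘ b)
        P = bucketMass c b (suc k)
        0≤m : 0# ≤ m
        0≤m = sum-nonneg λ i → 0≤⟨⟩ (is (suc k) (b i))
        scale : ∀ i → is (suc k) (b i) ≡ true → AtScale (cutoff t j) (p i) (suc k)
        scale i i∈B = ≡.subst (AtScale (cutoff t j) (p i)) (≡.sym (is-true (suc k) (b i) i∈B))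
          (scaleOf-correct (cutoff t j) (push-≤1 μ c i))
        m≤uP : m ≤ u * P
        m≤uP = ≤-respʳ (sym (scaled-bucketMass c b (suc k) u)) (sum-mono-≤ λ i →
          ≤-respˡ (*-identityʳ ⟨ is (suc k) (b i) ⟩) (indicator-≤ (is (suc k) (b i)) λ i∈B → proj₁ (scale i i∈B)))

      light : ∀ j {L} (c : Fin n → Fin L) → L ℕ.≤ suc (cutoff t (suc j)) →
              2# * bucketMass c (rescale j c) zero ≤ η
      light j {L} c L≤ = *-cancelˡ-≤ (0<x*y (0<2^ T) (0<2^ t)) (begin
        2# ^ T * 2# ^ t * (2# * P)
          ≈⟨ solve 3 (λ a b P → a :* b :* (two :* P) := two :* (b :* (a :* P))) refl (2# ^ T) (2# ^ t) P ⟩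
        2# * (2# ^ t * (2# ^ T * P))
          ≤⟨ *-monoˡ-≤ 0≤2 (*-monoˡ-≤ (proj₁ (0<2^ t)) 2^T*P≤L) ⟩
        2# * (2# ^ t * fromℕ L)
          ≈⟨ *-congˡ (trans (*-comm _ _) (trans (*-congˡ (sym (fromℕ-2^ t))) (sym (fromℕ-* L (2 ℕ.^ t))))) ⟩
        2# * fromℕ (L ℕ.* 2 ℕ.^ t)
          ≤⟨ *-monoˡ-≤ 0≤2 (fromℕ-mono-≤ (ℕₚ.≤-trans (ℕₚ.*-monoˡ-≤ (2 ℕ.^ t) L≤) (cutoff-suc t j))) ⟩
        2# * fromℕ (2 ℕ.^ T)
          ≈⟨ trans (*-congˡ (fromℕ-2^ T)) (*-comm _ _) ⟩
        2# ^ T * 2#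
          ≤⟨ *-monoˡ-≤ (proj₁ (0<2^ T)) 2≤2^t*η ⟩
        2# ^ T * (2# ^ t * η)
          ≈⟨ *-assoc _ _ _ ⟨
        2# ^ T * 2# ^ t * η ∎)
        where
        open ≤-Reasoning
        T : ℕ
        T = cutoff t j
        b : Fin L → Fin (suc T)
        b = rescale j c
        p : Vector Carrier L
        p = push c (prob μ)
        P : Carrier
        P = bucketMass c b zero
        scale : ∀ i → is zero (b i) ≡ true → 2# ^ T * p i ≤ 1#
        scale i i∈B = ≡.subst (AtScale T (p i)) (≡.sym (is-true zero (b i) i∈B)) (scaleOf-correct T (push-≤1 μ c i))
        2^T*P≤L : 2# ^ T * P ≤ fromℕ L
        2^T*P≤L = ≤-trans (≤-respˡ (sym (scaled-bucketMass c b zero (2# ^ T)))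
          (sum-mono-≤ λ i → ≤-respʳ (*-identityʳ ⟨ is zero (b i) ⟩) (indicator-≤ (is zero (b i)) (scale i))))
          (size≤ (is zero ∘ b))

      detection : ∀ j {L} → (Fin n → Fin L) → Carrier
      detection j c = ∑[ k < suc j ] 𝔼 ν (levels j c k) absgap

      -- The distances of consecutive levels telescope: each level but the last may lose
      -- η on negligible blocks, and after the last one a single block of mass 1 is left,
      -- where the distance is 0.
      distance-detection : ∀ j {L} (c : Fin n → Fin L) → L ℕ.≤ suc (cutoff t j) →
                       distance c ≤ 2# * 2# * C * detection j c + fromℕ j * η
      distance-detection zero c L≤ = begin
        distance c
          ≤⟨ distance-≤ c (λ _ → zero {0}) 0≤C (λ _ → 0#) (λ _ → ≤-refl)
               (λ B → inj₁ (one-bucket c (fromℕ-mono-≤ L≤) B)) ⟩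
        distance {1} (λ _ → zero) + K * E₀ + (0# + 0#)
          ≈⟨ +-congʳ (+-congʳ (trans (+-identityʳ _) (trans (abs-cong
               (trans (+-cong (whole μ) (-‿cong (whole ν))) (-‿inverseʳ 1#))) (abs-≥0 ≤-refl)))) ⟩
        0# + K * E₀ + (0# + 0#)
          ≈⟨ solve 3 (λ K e η → nil :+ K :* e :+ (nil :+ nil) := K :* (e :+ nil) :+ nil :* η) refl K E₀ η ⟩
        K * (E₀ + 0#) + 0# * η ∎
        where
        open ≤-Reasoning
        K E₀ : Carrier
        K = 2# * 2# * C
        E₀ = 𝔼 ν (round x₀ c λ _ → zero {0}) absgap
        whole : ∀ ν′ → push {n = 1} (λ _ → zero) (prob {n} ν′) zero ≈ 1#
        whole ν′ = trans (sum-cong λ x → *-identityˡ (prob ν′ x)) (prob-sum ν′)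
      distance-detection (suc j) c L≤ = begin
        distance c
          ≤⟨ distance-≤ c b 0≤C loss 0≤loss good ⟩
        distance (b ∘ c) + K * E₀ + (η + sum {cutoff t j} (λ _ → 0#))
          ≤⟨ +-mono-≤ (+-mono-≤ (distance-detection j (b ∘ c) ℕₚ.≤-refl) ≤-refl)
               (≤-reflexive (+-congˡ (sum-replicate-zero (cutoff t j)))) ⟩
        K * detection j (b ∘ c) + fromℕ j * η + K * E₀ + (η + 0#)
          ≈⟨ solve 5 (λ K s e j η → K :* s :+ j :* η :+ K :* e :+ (η :+ nil) :=
               K :* (e :+ s) :+ (one :+ j) :* η) refl K (detection j (b ∘ c)) E₀ (fromℕ j) η ⟩
        K * (E₀ + detection j (b ∘ c)) + fromℕ (suc j) * η ∎
        where
        open ≤-Reasoning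
        b = rescale j c
        K E₀ : Carrier
        K = 2# * 2# * C
        E₀ = 𝔼 ν (round x₀ c b) absgap
        loss : Vector Carrier (suc (cutoff t j))
        loss zero    = η
        loss (suc _) = 0#
        0≤loss : ∀ B → 0# ≤ loss B
        0≤loss zero    = 0≤η
        0≤loss (suc _) = ≤-refl
        good : ∀ B → Balanced c b C B ⊎ 2# * bucketMass c b B ≤ loss B
        good zero    = inj₂ (light j c L≤)
        good (suc k) = inj₁ (scale-balanced j c k)

  -- Iterated logarithms

  log-isSupremum : ∀ {x} → 0# < x → IsSupremum (BelowLog x) (log x)
  log-isSupremum {x} 0<x with 0# <? x
  ... | yes 0<x′ = proj₂ (log-supremum 0<x′)
  ... | no  0≮x  = contradiction 0<x 0≮x

  ≤-log : ∀ {x} a → 2# ^ a ≤ x → fromℕ a ≤ log x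
  ≤-log {x} a 2^a≤x = proj₁ (log-isSupremum (<-≤-trans (0<2^ a) 2^a≤x))
    (a , 0 , 0 , solve 1 (λ a → a :* (one :+ nil) := a :- nil) refl (fromℕ a) ,
      ≤-respʳ (solve 1 (λ x → x := x :* one :* one) refl x) 2^a≤x)

  tower≤log^ : ∀ k j {x} → fromℕ (tower (k ℕ.+ j)) ≤ x → fromℕ (tower j) ≤ log^ k x
  tower≤log^ zero    j p = p
  tower≤log^ (suc k) j {x} p = ≤-log (tower j) (≤-respˡ (fromℕ-2^ (tower j))
    (tower≤log^ k (suc j) (≡.subst (λ i → fromℕ (tower i) ≤ x) (≡.sym (ℕₚ.+-suc k j)) p)))

  -- Only the easy direction a ≤ log (2^a) of the logarithm is used: if n exceeded the
  -- tower, then the iterated logarithm would still be at least 2.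
  ≤-tower-log⋆ : ∀ n → n ℕ.≤ tower (log⋆ n)
  ≤-tower-log⋆ n with n ℕₚ.≤? tower (log⋆ n)
  ... | yes p  = p
  ... | no  n≰ = contradiction (≤-trans 2≤log^ log^≤1) (<⇒≱ 1<2)
    where
    K = log⋆ n
    log^≤1 : log^ K (fromℕ n) ≤ 1#
    log^≤1 = proj₁ (proj₂ (log⋆-least n))
    2≤log^ : fromℕ 2 ≤ log^ K (fromℕ n)
    2≤log^ = tower≤log^ K 0 (fromℕ-mono-≤ (ℕₚ.≤-trans
      (ℕₚ.≤-reflexive (≡.cong tower (ℕₚ.+-identityʳ K))) (ℕₚ.<⇒≤ (ℕₚ.≰⇒> n≰))))
    1<2 : 1# < fromℕ 2
    1<2 = 1≤fromℕ-suc 1 , λ 1≈2 → 1≉0 (trans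
      (solve 0 (one := (one :+ (one :+ nil)) :- one) refl)
      (trans (+-congʳ (sym 1≈2)) (-‿inverseʳ 1#)))

  -- For the least m with x ≤ 2^m, minimality gives 2^(m-1) ≤ x and so m - 1 ≤ log x.
  log-ceiling : ∀ {x} → 1# ≤ x → ∃ λ m → x ≤ 2# ^ m × fromℕ m ≤ log x + 1#
  log-ceiling {x} 1≤x with least (λ m → x ≤? 2# ^ m) bounded
    where
    bounded : ∃ λ m → x ≤ 2# ^ m
    bounded with archimedean x
    ... | m , x≤m = m , ≤-trans x≤m (≤-respʳ (fromℕ-2^ m)
          (fromℕ-mono-≤ (ℕₚ.≤-trans (ℕₚ.n≤1+n m) (suc≤2^ m))))
  ... | zero  , x≤ , _   = 0 , x≤ , +-nonneg (≤-log 0 1≤x) 0≤1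
  ... | suc m , x≤ , min = suc m , x≤ , ≤-respˡ (+-comm _ _)
        (+-monoˡ-≤ 1# (≤-log m (≰⇒≥ λ x≤2^m → ℕₚ.<-irrefl ≡.refl (min m x≤2^m))))

  -- Exponential decay

  product-^≤1 : ∀ {x y} → 0# ≤ x → 0# ≤ y → x * y ≤ 1# → ∀ k → x ^ k * y ^ k ≤ 1#
  product-^≤1 0≤x 0≤y xy≤1 zero    = ≤-reflexive (*-identityˡ 1#)
  product-^≤1 {x} {y} 0≤x 0≤y xy≤1 (suc k) = ≤-respˡ
    (solve 4 (λ x y a b → x :* y :* (a :* b) := x :* a :* (y :* b)) refl x y (x ^ k) (y ^ k))
    (≤-respʳ (*-identityˡ 1#) (*-mono-≤ (*-nonneg (0≤^ 0≤x k) (0≤^ 0≤y k)) 0≤1 xy≤1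
      (product-^≤1 0≤x 0≤y xy≤1 k)))

  -- Bernoulli gives 2 = 1 + Q κ ≤ (1 + κ)^Q, and (1 - κ)(1 + κ) ≤ 1, so Q steps
  -- at least halve.
  decay : ∀ {κ} Q → 0# ≤ κ → κ ≤ 1# → fromℕ Q * κ ≈ 1# → ∀ k →
          (1# - κ) ^ (Q ℕ.* k) * 2# ^ k ≤ 1#
  decay {κ} Q 0≤κ κ≤1 Qκ≈1 k = ≤-respˡ (*-congʳ (^-assocʳ (1# - κ) Q k))
    (product-^≤1 0≤ρ^Q 0≤2 halved k)
    where
    0≤ρ : 0# ≤ 1# - κ
    0≤ρ = x≤y⇒0≤y-x κ≤1
    0≤ρ^Q : 0# ≤ (1# - κ) ^ Q
    0≤ρ^Q = 0≤^ 0≤ρ Q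
    halved : (1# - κ) ^ Q * 2# ≤ 1#
    halved = ≤-trans
      (*-monoˡ-≤ 0≤ρ^Q (≤-respˡ (+-congˡ Qκ≈1) (bernoulli 0≤κ Q)))
      (product-^≤1 0≤ρ (+-nonneg 0≤1 0≤κ)
        (≤-by (κ * κ) (0≤x² κ) (solve 1 (λ k → one :- (one :- k) :* (one :+ k) := k :* k) refl κ)) Q)

  -- The polynomial

  bound-+ : ∀ a b {x y} → fromℕ a ≤ x → fromℕ b ≤ y → fromℕ (a ℕ.+ b) ≤ x + y
  bound-+ a b p q = ≤-respˡ (sym (fromℕ-+ a b)) (+-mono-≤ p q)

  bound-* : ∀ a b {x y} → fromℕ a ≤ x → fromℕ b ≤ y → fromℕ (a ℕ.* b) ≤ x * y
  bound-* a b p q = ≤-respˡ (sym (fromℕ-* a b)) (*-mono-≤ (0≤fromℕ b) (≤-trans (0≤fromℕ a) p) p q)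

  -- The expression for the number of samples, with e and m replaced by their upper
  -- bounds 1/ε + 1 and log (1/δ) + 1.
  bound : Polynomial 3
  bound = N ⊗ κ 3
    where
    κ : ℕ → Polynomial 3
    κ = Κ ∘ fromℕ
    w t C G H Q N m : Polynomial 3
    w = (κ 1 ⊕ Ι zero) ⊗ (Ι (suc zero) ⊕ Κ 1#)
    t = κ 1 ⊕ w
    C = κ 3 ⊕ (t ⊕ (t ⊕ κ 3))
    G = κ 4 ⊗ (C ⊗ w)
    H = G ⊗ G
    Q = κ 8 ⊗ (H ⊗ H)
    m = Ι (suc (suc zero)) ⊕ Κ 1#
    N = Q ⊗ (m ⊕ m)

  draws≤bound : ∀ K e m {x y} → fromℕ e ≤ x + 1# → fromℕ m ≤ y + 1# →
                fromℕ (Parameters.draws K e m) ≤ eval bound (fromℕ K ∷ x ∷ y ∷ [])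
  draws≤bound K e m {x} {y} e≤ m≤ = bound-* N 3 N≤ ≤-refl
    where
    open Parameters K e m
    κ : ∀ k → fromℕ k ≤ fromℕ k
    κ k = ≤-refl
    w≤ = bound-* (suc K) e (bound-+ 1 K (κ 1) (κ K)) e≤
    t≤ = bound-+ 1 w (κ 1) w≤
    C≤ = bound-+ 3 (t ℕ.+ (t ℕ.+ 3)) (κ 3) (bound-+ t (t ℕ.+ 3) t≤ (bound-+ t 3 t≤ (κ 3)))
    G≤ = bound-* 4 (C ℕ.* w) (κ 4) (bound-* C w C≤ w≤)
    H≤ = bound-* G G G≤ G≤
    N≤ = bound-* Q (m ℕ.+ m) (bound-* 8 (H ℕ.* H) (κ 8) (bound-* H H H≤ H≤)) (bound-+ m m m≤ m≤)

  -- The tester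

  module Construction {n} (x₀ : Fin n) (μ : Distribution n) (K e m : ℕ) (n≤tower : n ℕ.≤ tower K) where
    open Parameters K (suc e) m
    open Levels x₀ μ t using (levels; Draws≤-levels; detection; distance-detection)

    pick : Program n (Query n)
    pick = toss K (levels K id)

    trial : Program n (Sighting n)
    trial = interrogate μ pick

    Draws≤-trial : Draws≤ 3 trial
    Draws≤-trial = Draws≤-bind {c = 1} (toss λ k → Draws≤-levels K id k) λ q → draw λ x → draw λ y → ret

    -- The score has mean at least θ = 1/G² in the far case.  The factor
    -- 1 + 2 stake² - stake θ is least at stake = θ/4, where it is 1 - θ²/8 = 1 - κ.
    half γ θ stake κ bar : Carrier
    half = 2# ⁻¹
    γ = fromℕ G ⁻¹
    θ = γ * γ
    stake = half * half * θ
    κ = half * half * half * (θ * θ)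
    bar = 2# ^ m

    1≤G : 1# ≤ fromℕ G
    1≤G = ≤-respˡ fromℕ-1 (fromℕ-mono-≤ {1} {G} (s≤s z≤n))

    1≤Q : 1# ≤ fromℕ Q
    1≤Q = ≤-respˡ fromℕ-1 (fromℕ-mono-≤ {1} {Q} (s≤s z≤n))

    2*half : 2# * half ≈ 1#
    2*half = ⁻¹-inverse 0<2

    0≤half : 0# ≤ half
    0≤half = 0≤⁻¹ 0<2

    G*γ : fromℕ G * γ ≈ 1#
    G*γ = ⁻¹-inverse (<-≤-trans 0<1 1≤G)

    0≤γ : 0# ≤ γ
    0≤γ = 0≤⁻¹ (<-≤-trans 0<1 1≤G)

    inverse≤1 : ∀ {a x} → 1# ≤ a → 0# ≤ x → a * x ≈ 1# → x ≤ 1#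
    inverse≤1 1≤a 0≤x ax≈1 = ≤-respˡ (*-identityˡ _) (≤-respʳ ax≈1 (*-monoʳ-≤ 0≤x 1≤a))

    0≤θ : 0# ≤ θ
    0≤θ = 0≤x² γ

    0≤stake : 0# ≤ stake
    0≤stake = *-nonneg (*-nonneg 0≤half 0≤half) 0≤θ

    2*stake≤1 : 2# * stake ≤ 1#
    2*stake≤1 = ≤-respʳ (*-identityˡ 1#) (≤-respˡ
      (trans (sym (*-identityˡ _)) (trans (*-congʳ (sym 2*half))
        (solve 3 (λ t h a → t :* h :* (h :* a) := t :* (h :* h :* a)) refl 2# half θ)))
      (*-mono-≤ 0≤θ 0≤1
        (inverse≤1 (≤-by 1# 0≤1 (solve 0 (two :- one := one) refl)) 0≤half 2*half)
        (≤-respʳ (*-identityˡ 1#) (*-mono-≤ 0≤γ 0≤1 γ≤1 γ≤1))))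
      where
      γ≤1 : γ ≤ 1#
      γ≤1 = inverse≤1 1≤G 0≤γ G*γ

    Q*κ : fromℕ Q * κ ≈ 1#
    Q*κ = begin
      fromℕ Q * κ
        ≈⟨ *-congʳ (trans (fromℕ-* 8 (H ℕ.* H)) (*-congˡ (trans (fromℕ-* H H)
             (*-cong (fromℕ-* G G) (fromℕ-* G G))))) ⟩
      fromℕ 8 * (g * g * (g * g)) * (half * half * half * (γ * γ * (γ * γ)))
        ≈⟨ solve 3 (λ g h c →
             (one :+ (one :+ (one :+ (one :+ (one :+ (one :+ (one :+ (one :+ nil))))))))
               :* (g :* g :* (g :* g)) :* (h :* h :* h :* (c :* c :* (c :* c)))
             := (two :* h) :* (two :* h) :* (two :* h) :* ((g :* c) :* (g :* c) :* ((g :* c) :* (g :* c))))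
             refl g half γ ⟩
      2# * half * (2# * half) * (2# * half) * (g * γ * (g * γ) * (g * γ * (g * γ)))
        ≈⟨ *-cong (*-cong (*-cong 2*half 2*half) 2*half)
             (*-cong (*-cong G*γ G*γ) (*-cong G*γ G*γ)) ⟩
      1# * 1# * 1# * (1# * 1# * (1# * 1#))
        ≈⟨ solve 0 (one :* one :* one :* (one :* one :* (one :* one)) := one) refl ⟩
      1# ∎
      where
      open ≈-Reasoning
      g : Carrier
      g = fromℕ G

    0≤κ : 0# ≤ κ
    0≤κ = *-nonneg (*-nonneg (*-nonneg 0≤half 0≤half) 0≤half) (0≤x² θ)

    κ≤1 : κ ≤ 1#
    κ≤1 = inverse≤1 1≤Q 0≤κ Q*κ

    0≤bar : 0# ≤ bar
    0≤bar = proj₁ (0<2^ m)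

    open Betting trial (score μ) (λ z → proj₁ (score-bounds μ z)) (λ z → proj₂ (score-bounds μ z))
      bar stake 0≤bar 0≤stake 2*stake≤1

    tester : Program n Bool
    tester = play N 1#

    Draws≤-tester : Draws≤ draws tester
    Draws≤-tester = Draws≤-play Draws≤-trial N 1#

    rejects-rarely : ∀ ν → ν ≐ μ → bar * 𝔼 ν tester (⟨_⟩ ∘ not) ≤ 1#
    rejects-rarely ν ν≐μ = fair-bet ν 𝔼score≈0 N 0≤1
      where
      𝔼score≈0 : 𝔼 ν trial (score μ) ≈ 0#
      𝔼score≈0 = trans (𝔼-score μ ν pick) (trans
        (𝔼-cong ν pick λ q → *-cong (gap≈0 q) (gap≈0 q))
        (trans (𝔼-scale ν pick 0# λ _ → 0#) (zeroˡ _)))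
        where
        gap≈0 : ∀ q → gap μ ν q ≈ 0#
        gap≈0 q = trans (+-congˡ (-‿cong (rate-cong ν μ ν≐μ (domain q) (event q)))) (-‿inverseʳ _)

    ρ-bound : 1# + 2# * (stake * stake) - stake * θ ≤ 1# - κ
    ρ-bound = ≤-reflexive (begin
      1# + 2# * (stake * stake) - stake * θ
        ≈⟨ solve 2 (λ h a → one :+ two :* (h :* h :* a :* (h :* h :* a)) :- h :* h :* a :* a :=
             one :- h :* h :* a :* a :+ two :* h :* (h :* h :* h :* (a :* a))) refl half θ ⟩
      1# - half * half * θ * θ + 2# * half * κ
        ≈⟨ +-cong (+-congˡ (-‿cong (trans (sym (*-identityˡ _)) (*-congʳ (sym 2*half)))))
             (trans (*-congʳ 2*half) (*-identityˡ κ)) ⟩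
      1# - 2# * half * (half * half * θ * θ) + κ
        ≈⟨ solve 2 (λ h a → one :- two :* h :* (h :* h :* a :* a) :+ h :* h :* h :* (a :* a) :=
             one :- h :* h :* h :* (a :* a)) refl half θ ⟩
      1# - κ ∎)
      where open ≈-Reasoning

    -- After N = 2 m Q trials (1 - κ)^N ≤ 2^-2m, which makes up for the factor 2^m twice.
    accepts-rarely : ∀ ν → 1# ≤ fromℕ G * 𝔼 ν pick (λ q → abs (gap μ ν q)) → bar * 𝔼 ν tester ⟨_⟩ ≤ 1#
    accepts-rarely ν 1≤G*𝔼 = begin
      bar * 𝔼 ν tester ⟨_⟩
        ≈⟨ *-congˡ (*-identityˡ _) ⟨
      bar * (1# * 𝔼 ν tester ⟨_⟩)
        ≤⟨ *-monoˡ-≤ 0≤bar (favourable-bet (x≤y⇒0≤y-x κ≤1) ρ-bound ν θ≤𝔼score N 0≤1) ⟩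
      bar * (bar * (1# - κ) ^ N)
        ≈⟨ trans (sym (*-assoc _ _ _)) (trans (*-comm _ _) (*-congˡ (sym (^-homo-* 2# m m)))) ⟩
      (1# - κ) ^ N * 2# ^ (m ℕ.+ m)
        ≤⟨ decay Q 0≤κ κ≤1 Q*κ (m ℕ.+ m) ⟩
      1# ∎
      where
      open ≤-Reasoning
      γ≤𝔼 : γ ≤ 𝔼 ν pick (λ q → abs (gap μ ν q))
      γ≤𝔼 = *-cancelˡ-≤ (<-≤-trans 0<1 1≤G) (≤-respˡ (sym G*γ) 1≤G*𝔼)
      -- Jensen's inequality for the square, by its tangent g² ≥ 2 γ g - γ² at γ.
      θ≤𝔼score : θ ≤ 𝔼 ν trial (score μ)
      θ≤𝔼score = begin
        γ * γ
          ≤⟨ ≤-by (2# * γ * (E₁ - γ)) (*-nonneg (*-nonneg 0≤2 0≤γ) (x≤y⇒0≤y-x γ≤𝔼))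
               (solve 2 (λ g e → :- (g :* g) :+ two :* g :* e :- g :* g := two :* g :* (e :- g)) refl γ E₁) ⟩
        - (γ * γ) + 2# * γ * E₁
          ≈⟨ 𝔼-affine ν pick (- (γ * γ)) (2# * γ) (λ q → abs (gap μ ν q)) ⟨
        𝔼 ν pick (λ q → - (γ * γ) + 2# * γ * abs (gap μ ν q))
          ≤⟨ 𝔼-mono ν pick (λ q → ≤-respʳ (abs² (gap μ ν q))
               (≤-by ((abs (gap μ ν q) - γ) * (abs (gap μ ν q) - γ)) (0≤x² _)
                 (solve 2 (λ g a → a :* a :- (:- (g :* g) :+ two :* g :* a) := (a :- g) :* (a :- g))
                   refl γ (abs (gap μ ν q))))) ⟩
        𝔼 ν pick (λ q → gap μ ν q * gap μ ν q)
          ≈⟨ 𝔼-score μ ν pick ⟨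
        𝔼 ν trial (score μ) ∎
        where
        E₁ : Carrier
        E₁ = 𝔼 ν pick (λ q → abs (gap μ ν q))

    -- With η = ε / (K + 1) the negligible blocks of all levels cost at most ε of the
    -- L¹ distance 2 ε, so queries account for ε; the toss averages over K + 1 levels.
    far-detected : ∀ ν {ε} → 0# < ε → ε ⁻¹ ≤ fromℕ (suc e) → ε ≤ d μ ν →
                   1# ≤ fromℕ G * 𝔼 ν pick (λ q → abs (gap μ ν q))
    far-detected ν {ε} 0<ε ε⁻¹≤e ε≤d = begin
      1#
        ≈⟨ ⁻¹-inverse 0<ε ⟨
      ε * ε ⁻¹
        ≤⟨ *-monoˡ-≤ (proj₁ 0<ε) ε⁻¹≤e ⟩
      ε * fromℕ (suc e)
        ≤⟨ *-monoʳ-≤ (0≤fromℕ (suc e)) ε≤detected ⟩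
      2# * 2# * fromℕ C * S * fromℕ (suc e)
        ≈⟨ *-congʳ (*-congˡ S≈) ⟩
      2# * 2# * fromℕ C * (k * E₁) * fromℕ (suc e)
        ≈⟨ solve 4 (λ c k f e → two :* two :* c :* (k :* f) :* e :=
             (one :+ (one :+ (one :+ (one :+ nil)))) :* (c :* (k :* e)) :* f) refl (fromℕ C) k E₁ (fromℕ (suc e)) ⟩
      fromℕ 4 * (fromℕ C * (k * fromℕ (suc e))) * E₁
        ≈⟨ *-congʳ (trans (fromℕ-* 4 (C ℕ.* w)) (*-congˡ (trans (fromℕ-* C w)
             (*-congˡ (fromℕ-* (suc K) (suc e)))))) ⟨
      fromℕ G * E₁ ∎
      where
      open ≤-Reasoning
      k E₁ S η : Carrier
      k = fromℕ (suc K)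
      E₁ = 𝔼 ν pick (λ q → abs (gap μ ν q))
      η = ε * k ⁻¹
      k*k⁻¹ : k * k ⁻¹ ≈ 1#
      k*k⁻¹ = ⁻¹-inverse (0<fromℕ-suc K)
      0≤η : 0# ≤ η
      0≤η = *-nonneg (proj₁ 0<ε) (0≤⁻¹ (0<fromℕ-suc K))
      k*η : k * η ≈ ε
      k*η = trans (solve 3 (λ k e i → k :* (e :* i) := e :* (k :* i)) refl k ε (k ⁻¹))
        (trans (*-congˡ k*k⁻¹) (*-identityʳ ε))
      2≤2^t*η : 2# ≤ 2# ^ t * η
      2≤2^t*η = begin
        2#
          ≈⟨ *-identityʳ 2# ⟨
        2# * 1#
          ≈⟨ *-congˡ (⁻¹-inverse 0<ε) ⟨
        2# * (ε * ε ⁻¹)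
          ≤⟨ *-monoˡ-≤ 0≤2 (*-monoˡ-≤ (proj₁ 0<ε) ε⁻¹≤e) ⟩
        2# * (ε * fromℕ (suc e))
          ≈⟨ *-congˡ (*-congʳ k*η) ⟨
        2# * (k * η * fromℕ (suc e))
          ≈⟨ solve 4 (λ t k h e → t :* (k :* h :* e) := t :* (k :* e) :* h) refl 2# k η (fromℕ (suc e)) ⟩
        2# * (k * fromℕ (suc e)) * η
          ≈⟨ *-congʳ (*-congˡ (fromℕ-* (suc K) (suc e))) ⟨
        2# * fromℕ w * η
          ≤⟨ *-monoʳ-≤ 0≤η (*-monoˡ-≤ 0≤2 (≤-respʳ (fromℕ-2^ w)
               (fromℕ-mono-≤ (ℕₚ.≤-trans (ℕₚ.n≤1+n w) (suc≤2^ w))))) ⟩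
        2# * 2# ^ w * η ∎
      S = detection ν 0≤η 2≤2^t*η K id
      S≈ : S ≈ k * E₁
      S≈ = sym (trans
        (*-congˡ (sym (*-distribˡ-sum (k ⁻¹) λ i → 𝔼 ν (levels K id i) (λ q → abs (gap μ ν q)))))
        (trans (sym (*-assoc _ _ _)) (trans (*-congʳ k*k⁻¹) (*-identityˡ _))))
      distance-id : 2# * ε ≤ Level.distance x₀ μ ν id
      distance-id = begin
        2# * ε
          ≤⟨ *-monoˡ-≤ 0≤2 ε≤d ⟩
        2# * (half * ∑[ i < n ] abs (prob μ i - prob ν i))
          ≈⟨ trans (sym (*-assoc _ _ _)) (trans (*-congʳ 2*half) (*-identityˡ _)) ⟩
        ∑[ i < n ] abs (prob μ i - prob ν i)
          ≈⟨ sum-cong (λ i → abs-cong (+-cong (sum-isʳ (prob μ) i) (-‿cong (sum-isʳ (prob ν) i)))) ⟨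
        Level.distance x₀ μ ν id ∎
      fits : n ℕ.≤ suc (cutoff t K)
      fits = ℕₚ.≤-trans n≤tower (ℕₚ.≤-trans (ℕₚ.m≤m+n (tower K) _) (ℕₚ.n≤1+n _))
      ε≤detected : ε ≤ 2# * 2# * fromℕ C * S
      ε≤detected = begin
        ε
          ≈⟨ solve 1 (λ e → e := two :* e :- e) refl ε ⟩
        2# * ε - ε
          ≤⟨ +-monoˡ-≤ (- ε) (≤-trans distance-id (distance-detection ν 0≤η 2≤2^t*η K id fits)) ⟩
        2# * 2# * fromℕ C * S + fromℕ K * η - ε
          ≤⟨ +-monoˡ-≤ (- ε) (+-mono-≤ ≤-refl (≤-respʳ k*η
               (*-monoʳ-≤ 0≤η (fromℕ-mono-≤ (ℕₚ.n≤1+n K))))) ⟩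
        2# * 2# * fromℕ C * S + ε - ε
          ≈⟨ solve 2 (λ s e → s :+ e :- e := s) refl (2# * 2# * fromℕ C * S) ε ⟩
        2# * 2# * fromℕ C * S ∎

    rare : ∀ {δ x} → 0# < δ → δ ⁻¹ ≤ bar → bar * x ≤ 1# → 1# - δ ≤ 1# - x
    rare {δ} {x} 0<δ δ⁻¹≤bar bar*x≤1 = ≤-by (δ - x) (x≤y⇒0≤y-x x≤δ)
      (solve 2 (λ d x → one :- x :- (one :- d) := d :- x) refl δ x)
      where
      x≤δ : x ≤ δ
      x≤δ = *-cancelˡ-≤ (0<2^ m) (≤-trans bar*x≤1 (≤-respˡ (⁻¹-inverse 0<δ)
        (≤-respʳ (*-comm _ _) (*-monoˡ-≤ (proj₁ 0<δ) δ⁻¹≤bar))))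

    accepts : ∀ {δ} → 0# < δ → δ ⁻¹ ≤ bar → ∀ ν → ν ≐ μ → 1# - δ ≤ Pr ν (toAlgorithm tester) true
    accepts 0<δ δ⁻¹≤bar ν ν≐μ = ≤-respʳ
      (sym (trans (Pr-true ν tester) (𝔼-complement ν tester)))
      (rare 0<δ δ⁻¹≤bar (rejects-rarely ν ν≐μ))

    rejects : ∀ {ε δ} → 0# < ε → ε ⁻¹ ≤ fromℕ (suc e) → 0# < δ → δ ⁻¹ ≤ bar → ∀ ν → ε ≤ d μ ν →
              1# - δ ≤ Pr ν (toAlgorithm tester) false
    rejects 0<ε ε⁻¹≤e 0<δ δ⁻¹≤bar ν ε≤d = ≤-respʳ
      (sym (trans (Pr-false ν tester) (trans
        (solve 1 (λ r → r := one :- (one :- r)) refl _)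
        (+-congˡ (-‿cong (sym (𝔼-complement ν tester)))))))
      (rare 0<δ δ⁻¹≤bar (accepts-rarely ν (far-detected ν 0<ε ε⁻¹≤e ε≤d)))

  1≤⁻¹ : ∀ {x} → 0# < x → x < 1# → 1# ≤ x ⁻¹
  1≤⁻¹ 0<x (x≤1 , _) = *-cancelˡ-≤ 0<x
    (≤-respˡ (sym (*-identityʳ _)) (≤-respʳ (sym (⁻¹-inverse 0<x)) x≤1))

  -- Without points there is no distribution, and e ≥ 1 since ε < 1.
  identity-tester : (ε δ : Carrier) → 0# < ε → ε < 1# → 0# < δ → δ < 1# →
    (n : ℕ) (μ : Distribution n) →
    Σ (Algorithm n) λ T →
      fromℕ (sampleCount T) ≤ eval bound (fromℕ (log⋆ n) ∷ ε ⁻¹ ∷ log (δ ⁻¹) ∷ []) ×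
      ((μ′ : Distribution n) → μ′ ≐ μ → 1# - δ ≤ Pr μ′ T true) ×
      ((μ′ : Distribution n) → ε ≤ d μ μ′ → 1# - δ ≤ Pr μ′ T false)
  identity-tester ε δ 0<ε ε<1 0<δ δ<1 zero μ = contradiction (sym (prob-sum μ)) 1≉0
  identity-tester ε δ 0<ε ε<1 0<δ δ<1 n@(suc _) μ
    with ceiling (ε ⁻¹) | log-ceiling (1≤⁻¹ 0<δ δ<1)
  ... | zero  , ε⁻¹≤0 , _     | _ = contradiction (≤-trans (1≤⁻¹ 0<ε ε<1) ε⁻¹≤0) (<⇒≱ 0<1)
  ... | suc e , ε⁻¹≤e , e≤ε⁻¹ | m , δ⁻¹≤2^m , m≤log =
    toAlgorithm tester ,
    ≤-trans (fromℕ-mono-≤ (sampleCount-≤ Draws≤-tester))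
      (draws≤bound (log⋆ n) (suc e) m (e≤ε⁻¹ (1≤⁻¹ 0<ε ε<1)) m≤log) ,
    accepts 0<δ δ⁻¹≤2^m ,
    rejects 0<ε ε⁻¹≤e 0<δ δ⁻¹≤2^m
    where open Construction zero μ (log⋆ n) e m (≤-tower-log⋆ n)

theorem3p2p1 : (ℝ : CompleteOrderedField) → let open Reals ℝ in
    Σ (Polynomial 3) λ p →
    (ε δ : Carrier) → 0# < ε → ε < 1# → 0# < δ → δ < 1# →
    (n : ℕ) (μ : Distribution n) →
    Σ (Algorithm n) λ T →
    fromℕ (sampleCount T) ≤ eval p (fromℕ (log⋆ n) ∷ ε ⁻¹ ∷ log (δ ⁻¹) ∷ []) ×
    ((μ′ : Distribution n) → μ′ ≐ μ → 1# - δ ≤ Pr μ′ T true) ×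
    ((μ′ : Distribution n) → ε ≤ d μ μ′ → 1# - δ ≤ Pr μ′ T false)
theorem3p2p1 ℝ = bound , identity-tester
  where open Testing ℝ
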